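{- Let $\mathsf{L}(t)=\sum_{n=0}^\infty \mathcal{L}_n\frac{t^n}{n!}$ be the exponential generating function of the Lucas-Fubini numbers. For every integer $r\ge 1$, its $r$th derivative is $$\mathsf{L}^{(r)}(t)=\sum_{i=1}^{r}e^{it}{r \brace i} \left(\alpha^{i+1} e^{\alpha (e^t-1)}+\beta^{i+1} e^{\beta (e^t-1)}\right).$$
   Context: $\alpha=(1+\sqrt5)/2$ and $\beta=(1-\sqrt5)/2$. ${n\brace k}$ denotes the Stirling number of the second kind (the number of partitions of an $n$-element set into exactly $k$ non-empty blocks). $L_m$ denotes the Lucas numbers: $L_0=2$, $L_1=1$, $L_m=L_{m-1}+L_{m-2}$ for $m\ge2$. The Lucas-Fubini numbers are defined by $\mathcal{L}_n=\sum_{k=0}^n L_{k+1}{n\brace k}$ for $n\ge0$. The identity is one of formal power series in $t$, with derivative taken with respect to $t$. -}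

module Defs where

open import Algebra.Bundles using (RawMonoid; RawRing)
import Algebra.Definitions.RawMonoid as RawMonoidDefinitions
import Algebra.Definitions.RawSemiring as RawSemiringDefinitions
open import Data.Fin.Base using (toℕ)
open import Data.Fin.Subset using (Subset; inside; outside; Nonempty; Empty; _∩_; ⋃; ⊤)
open import Data.Fin.Subset.Properties using (nonempty?)
open import Data.Integer.Base using (+_)
open import Data.List.Base using (List; []; _∷_; _++_; map; filter; length)
open import Data.List.Relation.Unary.All using (All; all?)
open import Data.List.Relation.Unary.AllPairs using (AllPairs; allPairs?)
open import Data.Nat.Base as ℕ using (ℕ; zero; suc; _!; _∸_)
open import Data.Nat.Properties as ℕ using (_!≢0)
open import Data.Product.Base using (_×_)
open import Data.Rational.Base as ℚ using (ℚ; 0ℚ; 1ℚ; ½; _/_)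
import Data.Bool.Properties as Bool
import Data.Vec.Base as Vec
open import Data.Vec.Properties using (≡-dec)
open import Level using (Level; 0ℓ)
open import Relation.Binary.PropositionalEquality using (_≡_)
open import Relation.Nullary.Decidable using (Dec; ¬?; _×-dec_)

private
  variable
    a ℓ : Level
    A : Set a

------------------------------------------------------------------------
-- Finite sums

-- f m + f (m + 1) + … + f n, empty when m > n.
sumFromTo : (M : RawMonoid a ℓ) → ℕ → ℕ → (ℕ → RawMonoid.Carrier M) → RawMonoid.Carrier M
sumFromTo M m n f = sum {suc n ∸ m} (λ j → f (m ℕ.+ toℕ j))
  where open RawMonoidDefinitions M using (sum)

------------------------------------------------------------------------
-- Stirling numbers of the second kind

Disjoint : ∀ {n} → Subset n → Subset n → Set
Disjoint p q = Empty (p ∩ q)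

IsPartition : ∀ {n} → ℕ → List (Subset n) → Set
IsPartition k P = length P ≡ k × All Nonempty P × AllPairs Disjoint P × ⋃ P ≡ ⊤

isPartition? : ∀ {n} k (P : List (Subset n)) → Dec (IsPartition k P)
isPartition? k P =
  (length P ℕ.≟ k) ×-dec
  all? nonempty? P ×-dec
  allPairs? (λ p q → ¬? (nonempty? (p ∩ q))) P ×-dec
  ≡-dec Bool._≟_ (⋃ P) ⊤

subsets : ∀ n → List (Subset n)
subsets zero    = Vec.[] ∷ []
subsets (suc n) = map (inside Vec.∷_) (subsets n) ++ map (outside Vec.∷_) (subsets n)

sublists : List A → List (List A)
sublists []       = [] ∷ []
sublists (x ∷ xs) = map (x ∷_) (sublists xs) ++ sublists xs

-- `subsets n` lists every subset of Fin n exactly once, so `sublists (subsets n)`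
-- lists every (unordered) family of distinct subsets of Fin n exactly once.
stirling₂ : ℕ → ℕ → ℕ
stirling₂ n k = length (filter (isPartition? k) (sublists (subsets n)))

------------------------------------------------------------------------
-- Lucas and Lucas-Fubini numbers

lucas : ℕ → ℕ
lucas 0             = 2
lucas 1             = 1
lucas (suc (suc m)) = lucas (suc m) ℕ.+ lucas m

lucasFubini : ℕ → ℕ
lucasFubini n = sumFromTo ℕ.+-0-rawMonoid 0 n (λ k → lucas (suc k) ℕ.* stirling₂ n k)

------------------------------------------------------------------------
-- The field ℚ(√5)

-- ⟨ p , q ⟩ stands for p + q √5.  This field contains α, β and ℚ, hence every
-- coefficient of the series considered below.
record ℚ√5 : Set where
  constructor ⟨_,_⟩
  field
    rational irrational : ℚ

ℚ√5-rawRing : RawRing 0ℓ 0ℓ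
ℚ√5-rawRing = record
  { Carrier = ℚ√5
  ; _≈_     = _≡_
  ; _+_     = λ { ⟨ p , q ⟩ ⟨ r , s ⟩ → ⟨ p ℚ.+ r , q ℚ.+ s ⟩ }
  ; _*_     = λ { ⟨ p , q ⟩ ⟨ r , s ⟩ →
                  ⟨ p ℚ.* r ℚ.+ (+ 5 / 1) ℚ.* (q ℚ.* s) , p ℚ.* s ℚ.+ q ℚ.* r ⟩ }
  ; -_      = λ { ⟨ p , q ⟩ → ⟨ ℚ.- p , ℚ.- q ⟩ }
  ; 0#      = ⟨ 0ℚ , 0ℚ ⟩
  ; 1#      = ⟨ 1ℚ , 0ℚ ⟩
  }

fromℚ : ℚ → ℚ√5
fromℚ p = ⟨ p , 0ℚ ⟩

√5 : ℚ√5
√5 = ⟨ 0ℚ , 1ℚ ⟩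

module Scalar where
  open RawRing ℚ√5-rawRing public
  open RawSemiringDefinitions rawSemiring public using (_^_) renaming (_×_ to _×ⁿ_)

α β : ℚ√5
α = fromℚ ½ Scalar.* (Scalar.1# Scalar.+ √5)
β = fromℚ ½ Scalar.* (Scalar.1# Scalar.+ Scalar.- √5)

------------------------------------------------------------------------
-- Formal power series over ℚ(√5)

-- f n is the coefficient of tⁿ.
Series : Set
Series = ℕ → ℚ√5

seriesRawRing : RawRing 0ℓ 0ℓ
seriesRawRing = record
  { Carrier = Series
  ; _≈_     = λ f g → ∀ n → f n ≡ g n
  ; _+_     = λ f g n → f n Scalar.+ g n
  ; _*_     = λ f g n → sumFromTo Scalar.+-rawMonoid 0 n (λ k → f k Scalar.* g (n ∸ k))
  ; -_      = λ f n → Scalar.- f n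
  ; 0#      = λ n → Scalar.0#
  ; 1#      = λ { zero → Scalar.1# ; (suc n) → Scalar.0# }
  }

open RawRing seriesRawRing public using (_≈_; _+_; _*_; -_; 0#; 1#; +-rawMonoid)
open RawSemiringDefinitions (RawRing.rawSemiring seriesRawRing) public
  using (_^_) renaming (_×_ to _×ⁿ_)

infixl 6 _-_
_-_ : Series → Series → Series
f - g = f + (- g)

infixr 8 _•_
_•_ : ℚ√5 → Series → Series
(c • f) n = c Scalar.* f n

t : Series
t 1 = Scalar.1#
t _ = Scalar.0#

∂ : Series → Series
∂ f n = suc n Scalar.×ⁿ f (suc n)

∂^ : ℕ → Series → Series
∂^ zero    f = f
∂^ (suc r) f = ∂ (∂^ r f)

-- Substitution f(g(t)) for g with zero constant term: gᵏ then has no terms of degree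
-- below k, so only k ≤ n contribute to the coefficient of tⁿ.  It is meaningless for
-- other g.
infixr 9 _⟪_⟫
_⟪_⟫ : Series → Series → Series
(f ⟪ g ⟫) n = sumFromTo Scalar.+-rawMonoid 0 n (λ k → f k Scalar.* (g ^ k) n)

egf : (ℕ → ℕ) → Series
egf c n = fromℚ (_/_ (+ c n) (n !) {{n !≢0}})

-- e^g, for g with zero constant term.
exp : Series → Series
exp g = egf (λ _ → 1) ⟪ g ⟫

𝖫 : Series
𝖫 = egf lucasFubini

-- f m + … + f n, as series.
∑[_⋯_] : ℕ → ℕ → (ℕ → Series) → Series
∑[ m ⋯ n ] = sumFromTo +-rawMonoid m n

{-# OPTIONS --safe #-}

-- For x in ℚ(√5) put F x = exp (x (eᵗ − 1)).  Since ∂ (F x) = x eᵗ F x, the series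
-- G i = αⁱ⁺¹ F α + βⁱ⁺¹ F β satisfy ∂ (G i) = eᵗ G (i + 1), and the recurrence of the
-- Stirling numbers S gives ∂ʳ (G 0) = Σᵢ S(r,i) eⁱᵗ G i by induction on r.  By Binet's
-- formula, the constant terms of this identity say that r! [tʳ] G 0 is the r-th
-- Lucas-Fubini number.  Hence 𝖫 = G 0, and the identity is the theorem.
--
-- To get the recurrence from the definition of S, weight each family of k disjoint
-- nonempty subsets of an n-element set by m ^ (number of uncovered points).  The total
-- T(n,m,k) has T(n,0,k) = S(n,k), and removing a point of the n-element set gives
-- T(n+1,m,k+1) = m T(n,m,k+1) + T(n,m+1,k).  From this, induction on n proves
-- T(n,m+1,k) = T(n,m,k) + (k+1) T(n,m,k+1), and the case m = 0 is the recurrence.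

module Submission where

open import Defs using
  (sumFromTo; lucas; lucasFubini; Disjoint; isPartition?; subsets; sublists; stirling₂)
open import Algebra.Bundles using (CommutativeRing; Monoid)
import Algebra.Construct.Pointwise as Pointwise
import Algebra.Properties.CommutativeMonoid.Mult as CommutativeMonoidMult
import Algebra.Properties.CommutativeMonoid.Sum as CommutativeMonoidSum
import Algebra.Properties.CommutativeSemigroup as CommutativeSemigroupProperties
import Algebra.Properties.Monoid.Sum as MonoidSum
import Algebra.Properties.Ring as RingProperties
import Algebra.Properties.Semiring.Exp as SemiringExp
import Algebra.Properties.Semiring.Mult as SemiringMult
import Algebra.Properties.Semiring.Sum as SemiringSum
import Algebra.Solver.Ring.NaturalCoefficients.Default as RingSolver
open import Data.Fin.Base using (toℕ)
open import Data.Nat.Base as ℕ using (ℕ; zero; suc; _!; _∸_; _≤_; _<_; _≥_; z≤n; s≤s; NonZero)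
import Data.Nat.Properties as ℕ
open import Data.Product.Base using (_,_)
open import Function.Base using (_∘_)
open import Level using (Level; 0ℓ)
open import Relation.Binary.PropositionalEquality.Core as ≡ using (_≡_)
import Relation.Binary.Reasoning.Setoid as SetoidReasoning

-- Stirling numbers of the second kind

-- The textbook recurrence deletes a point from its block and then asks which of the blocks it came
-- from. For families listed as sublists in a fixed order this is awkward: the truncated block may
-- be empty, and it has to be put back at its place in the order. Here the truncated block `p` is
-- instead summed over all subsets, independently of the remaining family `Q`. Since weights vanish
-- unless the members are disjoint, this is in effect a sum over the subsets of the uncovered points
-- of `Q`, and by the binomial theorem it turns `m ^ u` into `(m + 1) ^ u`, where u is the number of
-- those points. Hence the parameter `m`, although partitions themselves are the case `m = 0`.

module Stirling where

  open import Data.Bool.Base using (Bool; true; false; _∧_)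
  import Data.Bool.Properties as Bool
  open import Data.Fin.Base using (zero; suc)
  open import Data.Fin.Subset using (Subset; inside; outside; Nonempty; _∩_; ⋃; ⊤)
  open import Data.Fin.Subset.Properties using (nonempty?; drop-∷-Empty)
  open import Data.List.Base using (List; []; _∷_; _++_; map; filter; length)
  open import Data.List.Properties using (length-++; length-map; map-++; map-∘; map-id)
  open import Data.List.Relation.Unary.All as All using (All; []; _∷_; all?)
  open import Data.List.Relation.Unary.AllPairs using (AllPairs; []; _∷_; allPairs?)
  open import Data.Nat.Base using (_+_; _*_; _<ᵇ_)
  open import Data.Nat.Properties
  open import Data.Nat.Tactic.RingSolver using (solve-∀)
  open import Data.Product.Base using (_×_; proj₁; proj₂)
  open import Data.Vec.Base as Vec using ([]; _∷_; here; there)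
  open import Data.Vec.Properties using (≡-dec; ∷-injective)
  open import Function.Bundles using (_⇔_; mk⇔)
  open import Relation.Binary.PropositionalEquality
  open import Relation.Nullary.Decidable using (Dec; does; ¬?; _×-dec_; dec-true; does-⇔)

  private
    variable
      a b p : Level
      A : Set a
      B : Set b

  -- Sums over lists and over sublists.

  ∑ : List A → (A → ℕ) → ℕ
  ∑ []       f = 0
  ∑ (x ∷ xs) f = f x + ∑ xs f

  ∑-cong : ∀ (xs : List A) {f g : A → ℕ} → (∀ x → f x ≡ g x) → ∑ xs f ≡ ∑ xs g
  ∑-cong []       f≗g = refl
  ∑-cong (x ∷ xs) f≗g = cong₂ _+_ (f≗g x) (∑-cong xs f≗g)

  ∑-zero : ∀ (xs : List A) → ∑ xs (λ _ → 0) ≡ 0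
  ∑-zero []       = refl
  ∑-zero (x ∷ xs) = ∑-zero xs

  ∑-++ : ∀ (xs ys : List A) (f : A → ℕ) → ∑ (xs ++ ys) f ≡ ∑ xs f + ∑ ys f
  ∑-++ []       ys f = refl
  ∑-++ (x ∷ xs) ys f = trans (cong (f x +_) (∑-++ xs ys f)) (sym (+-assoc (f x) _ _))

  ∑-map : ∀ (h : A → B) xs (f : B → ℕ) → ∑ (map h xs) f ≡ ∑ xs (f ∘ h)
  ∑-map h []       f = refl
  ∑-map h (x ∷ xs) f = cong (f (h x) +_) (∑-map h xs f)

  ∑-+ : ∀ (xs : List A) (f g : A → ℕ) → ∑ xs (λ x → f x + g x) ≡ ∑ xs f + ∑ xs g
  ∑-+ []       f g = refl
  ∑-+ (x ∷ xs) f g = trans (cong (f x + g x +_) (∑-+ xs f g)) (+-interchange (f x) (g x) (∑ xs f) (∑ xs g))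
    where
    +-interchange : ∀ a b c d → a + b + (c + d) ≡ a + c + (b + d)
    +-interchange = solve-∀

  ∑-*ˡ : ∀ m (xs : List A) (f : A → ℕ) → ∑ xs (λ x → m * f x) ≡ m * ∑ xs f
  ∑-*ˡ m []       f = sym (*-zeroʳ m)
  ∑-*ˡ m (x ∷ xs) f = trans (cong (m * f x +_) (∑-*ˡ m xs f)) (sym (*-distribˡ-+ m (f x) _))

  ∑-swap : ∀ (xs : List A) (ys : List B) (f : A → B → ℕ) →
           ∑ xs (λ x → ∑ ys (f x)) ≡ ∑ ys (λ y → ∑ xs (λ x → f x y))
  ∑-swap []       ys f = sym (∑-zero ys)
  ∑-swap (x ∷ xs) ys f = trans (cong (∑ ys (f x) +_) (∑-swap xs ys f)) (sym (∑-+ ys (f x) _))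

  ∑-sublists-map : ∀ (h : A → B) xs (f : List B → ℕ) → ∑ (sublists (map h xs)) f ≡ ∑ (sublists xs) (f ∘ map h)
  ∑-sublists-map h []       f = refl
  ∑-sublists-map h (x ∷ xs) f = begin
    ∑ (map (h x ∷_) (sublists (map h xs)) ++ sublists (map h xs)) f
      ≡⟨ ∑-++ (map (h x ∷_) (sublists (map h xs))) _ f ⟩
    ∑ (map (h x ∷_) (sublists (map h xs))) f + ∑ (sublists (map h xs)) f
      ≡⟨ cong₂ _+_ (trans (∑-map (h x ∷_) (sublists (map h xs)) f) (∑-sublists-map h xs _))
           (∑-sublists-map h xs f) ⟩
    ∑ (sublists xs) (f ∘ map h ∘ (x ∷_)) + ∑ (sublists xs) (f ∘ map h)
      ≡⟨ cong (_+ ∑ (sublists xs) (f ∘ map h)) (∑-map (x ∷_) (sublists xs) (f ∘ map h)) ⟨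
    ∑ (map (x ∷_) (sublists xs)) (f ∘ map h) + ∑ (sublists xs) (f ∘ map h)
      ≡⟨ ∑-++ (map (x ∷_) (sublists xs)) _ (f ∘ map h) ⟨
    ∑ (sublists (x ∷ xs)) (f ∘ map h) ∎
    where open ≡-Reasoning

  -- A sublist of a concatenation is a sublist of each part. `subsets (suc n)` is such a
  -- concatenation, so a family splits into the members through the new point and the others.
  ∑-sublists-++ : ∀ (xs ys : List A) (f : List A → ℕ) →
    ∑ (sublists (xs ++ ys)) f ≡ ∑ (sublists xs) (λ P → ∑ (sublists ys) (λ Q → f (P ++ Q)))
  ∑-sublists-++ []       ys f = sym (+-identityʳ _)
  ∑-sublists-++ (x ∷ xs) ys f = begin
    ∑ (map (x ∷_) (sublists (xs ++ ys)) ++ sublists (xs ++ ys)) f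
      ≡⟨ ∑-++ (map (x ∷_) (sublists (xs ++ ys))) _ f ⟩
    ∑ (map (x ∷_) (sublists (xs ++ ys))) f + ∑ (sublists (xs ++ ys)) f
      ≡⟨ cong₂ _+_ (trans (∑-map (x ∷_) (sublists (xs ++ ys)) f) (∑-sublists-++ xs ys _))
           (∑-sublists-++ xs ys f) ⟩
    ∑ (sublists xs) (F ∘ (x ∷_)) + ∑ (sublists xs) F
      ≡⟨ cong (_+ ∑ (sublists xs) F) (∑-map (x ∷_) (sublists xs) F) ⟨
    ∑ (map (x ∷_) (sublists xs)) F + ∑ (sublists xs) F
      ≡⟨ ∑-++ (map (x ∷_) (sublists xs)) _ F ⟨
    ∑ (sublists (x ∷ xs)) F ∎
    where
    open ≡-Reasoning
    F = λ P → ∑ (sublists ys) (λ Q → f (P ++ Q))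

  𝟙 : Bool → ℕ
  𝟙 true  = 1
  𝟙 false = 0

  𝟙-∧ : ∀ x y → 𝟙 (x ∧ y) ≡ 𝟙 x * 𝟙 y
  𝟙-∧ true  y = sym (+-identityʳ _)
  𝟙-∧ false y = refl

  length-filter-∑ : ∀ {P : A → Set p} (P? : ∀ x → Dec (P x)) xs →
                    length (filter P? xs) ≡ ∑ xs (λ x → 𝟙 (does (P? x)))
  length-filter-∑ P? []       = refl
  length-filter-∑ P? (x ∷ xs) with does (P? x)
  ... | true  = cong suc (length-filter-∑ P? xs)
  ... | false = length-filter-∑ P? xs

  -- The factor contributed by a point that lies in `d` members: `m` if it is uncovered, 1 if it is
  -- covered once, 0 if two members share it.
  χ : ℕ → ℕ → ℕ
  χ m 0             = m
  χ m 1             = 1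
  χ m (suc (suc d)) = 0

  -- One further member either contains the point or misses it: the binomial theorem for a single
  -- point.
  χ-suc : ∀ m d → χ m (suc d) + χ m d ≡ χ (suc m) d
  χ-suc m 0             = refl
  χ-suc m 1             = refl
  χ-suc m (suc (suc d)) = refl

  -- Here one member through the point is already chosen, so any further one gives the factor 0 and
  -- the empty sublist alone survives.
  ∑-χ-suc : ∀ m (xs : List A) (f : List A → ℕ) → ∑ (sublists xs) (λ P → χ m (suc (length P)) * f P) ≡ f []
  ∑-χ-suc m []       f = trans (+-identityʳ _) (+-identityʳ _)
  ∑-χ-suc m (x ∷ xs) f = begin
    ∑ (map (x ∷_) (sublists xs) ++ sublists xs) g      ≡⟨ ∑-++ (map (x ∷_) (sublists xs)) _ g ⟩
    ∑ (map (x ∷_) (sublists xs)) g + ∑ (sublists xs) g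
      ≡⟨ cong₂ _+_ (trans (∑-map (x ∷_) (sublists xs) g) (∑-zero (sublists xs))) (∑-χ-suc m xs f) ⟩
    f []                                               ∎
    where
    open ≡-Reasoning
    g = λ P → χ m (suc (length P)) * f P

  -- At most one member may contain a given point, so the sum collapses to the empty sublist and the
  -- singletons.
  ∑-χ : ∀ m (xs : List A) (f : List A → ℕ) →
        ∑ (sublists xs) (λ P → χ m (length P) * f P) ≡ m * f [] + ∑ xs (λ x → f (x ∷ []))
  ∑-χ m []       f = refl
  ∑-χ m (x ∷ xs) f = begin
    ∑ (map (x ∷_) (sublists xs) ++ sublists xs) g       ≡⟨ ∑-++ (map (x ∷_) (sublists xs)) _ g ⟩
    ∑ (map (x ∷_) (sublists xs)) g + ∑ (sublists xs) g
      ≡⟨ cong₂ _+_ (trans (∑-map (x ∷_) (sublists xs) g) (∑-χ-suc m xs (f ∘ (x ∷_)))) (∑-χ m xs f) ⟩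
    f (x ∷ []) + (m * f [] + ∑ xs (λ y → f (y ∷ [])))   ≡⟨ swap (f (x ∷ [])) (m * f []) _ ⟩
    m * f [] + (f (x ∷ []) + ∑ xs (λ y → f (y ∷ [])))   ∎
    where
    open ≡-Reasoning
    g = λ P → χ m (length P) * f P
    swap : ∀ a b c → a + (b + c) ≡ b + (a + c)
    swap = solve-∀

  degree₀ : ∀ {n} → List (Subset (suc n)) → ℕ
  degree₀ []                  = 0
  degree₀ ((inside  ∷ _) ∷ P) = suc (degree₀ P)
  degree₀ ((outside ∷ _) ∷ P) = degree₀ P

  -- For pairwise disjoint P, weight m P = m ^ (number of points outside ⋃ P), and it
  -- vanishes for other P.
  weight : ∀ {n} → ℕ → List (Subset n) → ℕ
  weight {zero}  m P = 1
  weight {suc n} m P = χ m (degree₀ P) * weight m (map Vec.tail P)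

  -- The product of `χ-suc` over all points: each uncovered point may join `p` or stay uncovered.
  -- The empty `p` is included; it arises when the block was a singleton before its point was
  -- removed.
  ∑-weight-∷ : ∀ n m (P : List (Subset n)) → ∑ (subsets n) (λ p → weight m (p ∷ P)) ≡ weight (suc m) P
  ∑-weight-∷ zero    m P = refl
  ∑-weight-∷ (suc n) m P = begin
    ∑ (map (inside ∷_) (subsets n) ++ map (outside ∷_) (subsets n)) w
      ≡⟨ ∑-++ (map (inside ∷_) (subsets n)) _ w ⟩
    ∑ (map (inside ∷_) (subsets n)) w + ∑ (map (outside ∷_) (subsets n)) w
      ≡⟨ cong₂ _+_ (∑-map (inside ∷_) (subsets n) w) (∑-map (outside ∷_) (subsets n) w) ⟩
    ∑ (subsets n) (λ p → χ m (suc d) * weight m (p ∷ P′)) + ∑ (subsets n) (λ p → χ m d * weight m (p ∷ P′))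
      ≡⟨ cong₂ _+_ (∑-*ˡ (χ m (suc d)) (subsets n) _) (∑-*ˡ (χ m d) (subsets n) _) ⟩
    χ m (suc d) * ∑ (subsets n) (λ p → weight m (p ∷ P′)) + χ m d * ∑ (subsets n) (λ p → weight m (p ∷ P′))
      ≡⟨ *-distribʳ-+ (∑ (subsets n) (λ p → weight m (p ∷ P′))) (χ m (suc d)) (χ m d) ⟨
    (χ m (suc d) + χ m d) * ∑ (subsets n) (λ p → weight m (p ∷ P′))
      ≡⟨ cong₂ _*_ (χ-suc m d) (∑-weight-∷ n m P′) ⟩
    χ (suc m) d * weight (suc m) P′ ∎
    where
    open ≡-Reasoning
    d = degree₀ P
    P′ = map Vec.tail P
    w = λ p → weight m (p ∷ P)

  -- Splitting a family at one point.

  module _ {n : ℕ} where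

    infixr 5 _⋈_
    -- `P` lists the blocks through the new point, with that point removed, and `Q` those that avoid
    -- it.
    _⋈_ : List (Subset n) → List (Subset n) → List (Subset (suc n))
    P ⋈ Q = map (inside ∷_) P ++ map (outside ∷_) Q

    length-⋈ : ∀ P Q → length (P ⋈ Q) ≡ length P + length Q
    length-⋈ P Q = trans (length-++ (map (inside ∷_) P)) (cong₂ _+_ (length-map _ P) (length-map _ Q))

    tails-⋈ : ∀ P Q → map Vec.tail (P ⋈ Q) ≡ P ++ Q
    tails-⋈ P Q = trans (map-++ Vec.tail (map (inside ∷_) P) _)
      (cong₂ _++_ (trans (sym (map-∘ P)) (map-id P)) (trans (sym (map-∘ Q)) (map-id Q)))

    degree₀-⋈ : ∀ P Q → degree₀ (P ⋈ Q) ≡ length P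
    degree₀-⋈ (_ ∷ P) Q       = cong suc (degree₀-⋈ P Q)
    degree₀-⋈ []      []      = refl
    degree₀-⋈ []      (_ ∷ Q) = degree₀-⋈ [] Q

    Nonempty-out⇔ : ∀ (p : Subset n) → Nonempty (outside ∷ p) ⇔ Nonempty p
    Nonempty-out⇔ p = mk⇔ (λ { (suc x , there x∈p) → x , x∈p }) (λ (x , x∈p) → suc x , there x∈p)

    -- Members coming from `P` contain the new point, so the truncated blocks themselves are free to
    -- be empty.
    all-nonempty?-⋈ : ∀ P Q → does (all? nonempty? (P ⋈ Q)) ≡ does (all? nonempty? Q)
    all-nonempty?-⋈ P Q = does-⇔ (mk⇔ (⇒ P Q) (⇐ P Q)) (all? nonempty? (P ⋈ Q)) (all? nonempty? Q)
      where
      open Function.Bundles.Equivalence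
      ⇒ : ∀ P Q → All Nonempty (P ⋈ Q) → All Nonempty Q
      ⇒ (_ ∷ P) Q       (_ ∷ ne) = ⇒ P Q ne
      ⇒ []      []      []       = []
      ⇒ []      (q ∷ Q) (x ∷ ne) = to (Nonempty-out⇔ q) x ∷ ⇒ [] Q ne
      ⇐ : ∀ P Q → All Nonempty Q → All Nonempty (P ⋈ Q)
      ⇐ (_ ∷ P) Q       ne       = (zero , here) ∷ ⇐ P Q ne
      ⇐ []      []      []       = []
      ⇐ []      (q ∷ Q) (x ∷ ne) = from (Nonempty-out⇔ q) x ∷ ⇐ [] Q ne

  partialPartitions : ℕ → ℕ → ℕ → ℕ
  partialPartitions n m k = ∑ (sublists (subsets n)) λ P →
    𝟙 (does (length P ≟ k)) * (𝟙 (does (all? nonempty? P)) * weight m P)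

  private
    -- What is left of a summand once the factor of the new point is split off. At `P = []` it is
    -- the summand of `partialPartitions` itself.
    term : ∀ {n} → ℕ → ℕ → List (Subset n) → List (Subset n) → ℕ
    term m k P Q = 𝟙 (does (length P + length Q ≟ k)) * (𝟙 (does (all? nonempty? Q)) * weight m (P ++ Q))

    term-⋈ : ∀ {n} m k (P Q : List (Subset n)) →
      𝟙 (does (length (P ⋈ Q) ≟ k)) * (𝟙 (does (all? nonempty? (P ⋈ Q))) * weight m (P ⋈ Q)) ≡
      χ m (length P) * term m k P Q
    term-⋈ m k P Q
      rewrite length-⋈ P Q | all-nonempty?-⋈ P Q | degree₀-⋈ P Q | tails-⋈ P Q =
      rearrange (𝟙 (does (length P + length Q ≟ k))) (𝟙 (does (all? nonempty? Q)))
        (χ m (length P)) (weight m (P ++ Q))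
      where
      rearrange : ∀ a b c d → a * (b * (c * d)) ≡ c * (a * (b * d))
      rearrange = solve-∀

    -- The two cases of `∑-χ`: the new point is uncovered, with factor `m`, or it lies in exactly
    -- one block, whose other points form `p`.
    partialPartitions-suc : ∀ n m k → partialPartitions (suc n) m k ≡
      m * partialPartitions n m k +
      ∑ (subsets n) (λ p → ∑ (sublists (subsets n)) (term m k (p ∷ [])))
    partialPartitions-suc n m k = begin
      partialPartitions (suc n) m k
        ≡⟨ ∑-sublists-++ (map (inside ∷_) (subsets n)) (map (outside ∷_) (subsets n)) f ⟩
      ∑ (sublists (map (inside ∷_) (subsets n))) (λ P →
        ∑ (sublists (map (outside ∷_) (subsets n))) (λ Q → f (P ++ Q)))
        ≡⟨ ∑-sublists-map (inside ∷_) (subsets n) _ ⟩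
      ∑ (sublists (subsets n)) (λ P →
        ∑ (sublists (map (outside ∷_) (subsets n))) (λ Q → f (map (inside ∷_) P ++ Q)))
        ≡⟨ ∑-cong (sublists (subsets n)) (λ P →
             ∑-sublists-map (outside ∷_) (subsets n) (λ Q → f (map (inside ∷_) P ++ Q))) ⟩
      ∑ (sublists (subsets n)) (λ P → ∑ (sublists (subsets n)) (λ Q → f (P ⋈ Q)))
        ≡⟨ ∑-cong (sublists (subsets n)) (λ P → trans
             (∑-cong (sublists (subsets n)) (term-⋈ m k P))
             (∑-*ˡ (χ m (length P)) (sublists (subsets n)) _)) ⟩
      ∑ (sublists (subsets n)) (λ P → χ m (length P) * ∑ (sublists (subsets n)) (term m k P))
        ≡⟨ ∑-χ m (subsets n) _ ⟩
      m * partialPartitions n m k + ∑ (subsets n) (λ p → ∑ (sublists (subsets n)) (term m k (p ∷ []))) ∎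
      where
      open ≡-Reasoning
      f : List (Subset (suc n)) → ℕ
      f P = 𝟙 (does (length P ≟ k)) * (𝟙 (does (all? nonempty? P)) * weight m P)

  partialPartitions-zero-suc : ∀ m k → partialPartitions 0 m (suc k) ≡ 0
  partialPartitions-zero-suc m k = trans (+-identityʳ _) (*-zeroʳ (𝟙 (does (1 ≟ suc k))))

  partialPartitions-suc-zero : ∀ n m → partialPartitions (suc n) m 0 ≡ m * partialPartitions n m 0
  partialPartitions-suc-zero n m = begin
    partialPartitions (suc n) m 0
      ≡⟨ partialPartitions-suc n m 0 ⟩
    -- A family containing `p` is not empty, so the test for length 0 computes to `false` and the
    -- summand to 0.
    m * partialPartitions n m 0 + ∑ (subsets n) (λ p → ∑ (sublists (subsets n)) (λ _ → 0))
      ≡⟨ cong (m * partialPartitions n m 0 +_) (trans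
           (∑-cong (subsets n) (λ _ → ∑-zero (sublists (subsets n)))) (∑-zero (subsets n))) ⟩
    m * partialPartitions n m 0 + 0
      ≡⟨ +-identityʳ _ ⟩
    m * partialPartitions n m 0 ∎
    where open ≡-Reasoning

  partialPartitions-suc-suc : ∀ n m k →
    partialPartitions (suc n) m (suc k) ≡ m * partialPartitions n m (suc k) + partialPartitions n (suc m) k
  partialPartitions-suc-suc n m k = trans (partialPartitions-suc n m (suc k))
    (cong (m * partialPartitions n m (suc k) +_) (begin
    ∑ (subsets n) (λ p → ∑ (sublists (subsets n)) (term m (suc k) (p ∷ [])))
      -- For fixed `Q`, the set `p` matters only to the weight: in the length test it cancels the
      -- successor of `suc k`, and it is exempt from the nonemptiness test. So `∑-weight-∷` applies
      -- to the inner sum.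
      ≡⟨ ∑-swap (subsets n) (sublists (subsets n)) _ ⟩
    ∑ (sublists (subsets n)) (λ Q → ∑ (subsets n) (λ p → term m (suc k) (p ∷ []) Q))
      ≡⟨ ∑-cong (sublists (subsets n)) (λ Q →
           trans (∑-*ˡ (𝟙 (does (length Q ≟ k))) (subsets n) _) (cong (𝟙 (does (length Q ≟ k)) *_)
           (trans (∑-*ˡ (𝟙 (does (all? nonempty? Q))) (subsets n) _) (cong (𝟙 (does (all? nonempty? Q)) *_)
           (∑-weight-∷ n m Q))))) ⟩
    partialPartitions n (suc m) k ∎))
    where open ≡-Reasoning

  -- Give each uncovered point one of `m + 1` colours. If the last colour does not occur, `m`
  -- colours are left. Otherwise its points form an additional block, and `suc k` counts the ways to
  -- mark that block among the resulting `suc k` blocks.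
  partialPartitions-suc-m : ∀ n m k → partialPartitions n (suc m) k ≡
    partialPartitions n m k + suc k * partialPartitions n m (suc k)
  partialPartitions-suc-m zero m zero    = cong (1 +_)
    (sym (trans (*-identityˡ (partialPartitions 0 m 1)) (partialPartitions-zero-suc m 0)))
  partialPartitions-suc-m zero m (suc k)
    rewrite partialPartitions-zero-suc (suc m) k | partialPartitions-zero-suc m (suc k) =
    sym (*-zeroʳ (suc (suc k)))
  partialPartitions-suc-m (suc n) m zero
    rewrite partialPartitions-suc-zero n (suc m) | partialPartitions-suc-zero n m
          | partialPartitions-suc-suc n m 0
          | partialPartitions-suc-m n m 0 = arith m (partialPartitions n m 0) (partialPartitions n m 1)
    where
    arith : ∀ m x y → suc m * (x + 1 * y) ≡ m * x + 1 * (m * y + (x + 1 * y))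
    arith = solve-∀
  partialPartitions-suc-m (suc n) m (suc k)
    -- Everything is reduced to the three values at `n` and `m` with indices `k`, `k + 1` and
    -- `k + 2`. The induction hypothesis is used at `suc m` as well, so `m` has to vary.
    rewrite partialPartitions-suc-suc n (suc m) k | partialPartitions-suc-suc n m k
          | partialPartitions-suc-suc n m (suc k)
          | partialPartitions-suc-m n (suc m) k | partialPartitions-suc-m n m k
          | partialPartitions-suc-m n m (suc k) =
    arith m k (partialPartitions n m k) (partialPartitions n m (suc k)) (partialPartitions n m (suc (suc k)))
    where
    arith : ∀ m k x y z →
      suc m * (y + suc (suc k) * z) + ((x + suc k * y) + suc k * (y + suc (suc k) * z)) ≡
      (m * y + (x + suc k * y)) + suc (suc k) * (m * z + (y + suc (suc k) * z))
    arith = solve-∀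

  -- Exact covers as the families of weight 1 at `m = 0`.

  Exact : ∀ {n} → List (Subset n) → Set
  Exact P = AllPairs Disjoint P × ⋃ P ≡ ⊤

  exact? : ∀ {n} (P : List (Subset n)) → Dec (Exact P)
  exact? P = allPairs? (λ p q → ¬? (nonempty? (p ∩ q))) P ×-dec ≡-dec Bool._≟_ (⋃ P) ⊤

  ⋃-∷ : ∀ {n} (P : List (Subset (suc n))) → ⋃ P ≡ (0 <ᵇ degree₀ P) ∷ ⋃ (map Vec.tail P)
  ⋃-∷ []                  = refl
  ⋃-∷ ((inside  ∷ p) ∷ P) rewrite ⋃-∷ P = refl
  ⋃-∷ ((outside ∷ p) ∷ P) rewrite ⋃-∷ P = refl

  Disjoint-tail : ∀ {n} (p : Subset (suc n)) q → Disjoint p q → Disjoint (Vec.tail p) (Vec.tail q)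
  Disjoint-tail (_ ∷ p) (_ ∷ q) = drop-∷-Empty

  Disjoint-out : ∀ {n} (p : Subset n) q → Disjoint p (Vec.tail q) → Disjoint (outside ∷ p) q
  Disjoint-out p (_ ∷ q) p#q (suc x , there x∈) = p#q (x , x∈)

  AllDisjoint-tails : ∀ {n} p (P : List (Subset (suc n))) →
    All (Disjoint p) P → All (Disjoint (Vec.tail p)) (map Vec.tail P)
  AllDisjoint-tails p []      []       = []
  AllDisjoint-tails p (q ∷ P) (d ∷ ds) = Disjoint-tail p q d ∷ AllDisjoint-tails p P ds

  AllDisjoint-out : ∀ {n} (p : Subset n) P → All (Disjoint p) (map Vec.tail P) → All (Disjoint (outside ∷ p)) P
  AllDisjoint-out p []      []       = []
  AllDisjoint-out p (q ∷ P) (d ∷ ds) = Disjoint-out p q d ∷ AllDisjoint-out p P ds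

  AllDisjoint-in⇒ : ∀ {n} (p : Subset n) P → All (Disjoint (inside ∷ p)) P → degree₀ P ≡ 0
  AllDisjoint-in⇒ p []                  []       = refl
  AllDisjoint-in⇒ p ((inside  ∷ q) ∷ P) (d ∷ ds) with () ← d (zero , here)
  AllDisjoint-in⇒ p ((outside ∷ q) ∷ P) (d ∷ ds) = AllDisjoint-in⇒ p P ds

  AllDisjoint-in⇐ : ∀ {n} (p : Subset n) P → degree₀ P ≡ 0 →
    All (Disjoint p) (map Vec.tail P) → All (Disjoint (inside ∷ p)) P
  AllDisjoint-in⇐ p []                  _   []       = []
  AllDisjoint-in⇐ p ((outside ∷ q) ∷ P) eq  (d ∷ ds) =
    (λ { (suc x , there x∈) → d (x , x∈) }) ∷ AllDisjoint-in⇐ p P eq ds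

  AllPairs-Disjoint⇒ : ∀ {n} (P : List (Subset (suc n))) → AllPairs Disjoint P →
    degree₀ P ≤ 1 × AllPairs Disjoint (map Vec.tail P)
  AllPairs-Disjoint⇒ []                  []       = z≤n , []
  AllPairs-Disjoint⇒ ((inside  ∷ p) ∷ P) (d ∷ ds) =
    s≤s (≤-reflexive (AllDisjoint-in⇒ p P d)) , AllDisjoint-tails _ P d ∷ proj₂ (AllPairs-Disjoint⇒ P ds)
  AllPairs-Disjoint⇒ ((outside ∷ p) ∷ P) (d ∷ ds) =
    proj₁ (AllPairs-Disjoint⇒ P ds) , AllDisjoint-tails _ P d ∷ proj₂ (AllPairs-Disjoint⇒ P ds)

  AllPairs-Disjoint⇐ : ∀ {n} (P : List (Subset (suc n))) → degree₀ P ≤ 1 →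
    AllPairs Disjoint (map Vec.tail P) → AllPairs Disjoint P
  AllPairs-Disjoint⇐ []                  _       []       = []
  AllPairs-Disjoint⇐ ((inside  ∷ p) ∷ P) (s≤s d≤0) (d ∷ ds) =
    AllDisjoint-in⇐ p P (n≤0⇒n≡0 d≤0) d ∷ AllPairs-Disjoint⇐ P (≤-trans d≤0 z≤n) ds
  AllPairs-Disjoint⇐ ((outside ∷ p) ∷ P) d≤1     (d ∷ ds) =
    AllDisjoint-out p P d ∷ AllPairs-Disjoint⇐ P d≤1 ds

  -- Disjointness says that no point is covered twice, the union that no point is missed. Both
  -- conditions can be checked point by point, which matches the recursion of `weight`.
  exact-suc⇔ : ∀ {n} (P : List (Subset (suc n))) → Exact P ⇔ (degree₀ P ≡ 1 × Exact (map Vec.tail P))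
  exact-suc⇔ {n} P = mk⇔ ⇒ ⇐
    where
    positive : ∀ d → (0 <ᵇ d) ≡ true → 1 ≤ d
    positive (suc d) _ = s≤s z≤n
    ⇒ : Exact P → degree₀ P ≡ 1 × Exact (map Vec.tail P)
    ⇒ (disjoint , cover) with AllPairs-Disjoint⇒ P disjoint | ∷-injective (trans (sym (⋃-∷ P)) cover)
    ... | d≤1 , disjoint′ | 0<d , cover′ = ≤-antisym d≤1 (positive _ 0<d) , disjoint′ , cover′
    ⇐ : degree₀ P ≡ 1 × Exact (map Vec.tail P) → Exact P
    ⇐ (d≡1 , disjoint , cover) = AllPairs-Disjoint⇐ P (≤-reflexive d≡1) disjoint ,
      trans (⋃-∷ P) (cong₂ (λ d q → (0 <ᵇ d) ∷ q) d≡1 cover)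

  𝟙-exact? : ∀ {n} (P : List (Subset n)) → 𝟙 (does (exact? P)) ≡ weight 0 P
  -- Over the empty set every list is exact, even one that repeats the empty subset; this agrees
  -- with the empty product 1.
  𝟙-exact? {zero}  P = cong 𝟙 (dec-true (exact? P) (disjoint P , empty (⋃ P)))
    where
    empty : (p : Subset 0) → p ≡ []
    empty [] = refl
    disjoint : ∀ (P : List (Subset 0)) → AllPairs Disjoint P
    disjoint []      = []
    disjoint (p ∷ P) = All.universal (λ _ ()) P ∷ disjoint P
  𝟙-exact? {suc n} P = begin
    𝟙 (does (exact? P))
      ≡⟨ cong 𝟙 (does-⇔ (exact-suc⇔ P) (exact? P) (degree₀ P ≟ 1 ×-dec exact? (map Vec.tail P))) ⟩
    𝟙 (does (degree₀ P ≟ 1) ∧ does (exact? (map Vec.tail P)))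
      ≡⟨ 𝟙-∧ (does (degree₀ P ≟ 1)) _ ⟩
    𝟙 (does (degree₀ P ≟ 1)) * 𝟙 (does (exact? (map Vec.tail P)))
      ≡⟨ cong₂ _*_ (χ₀ (degree₀ P)) (𝟙-exact? (map Vec.tail P)) ⟩
    χ 0 (degree₀ P) * weight 0 (map Vec.tail P) ∎
    where
    open ≡-Reasoning
    χ₀ : ∀ d → 𝟙 (does (d ≟ 1)) ≡ χ 0 d
    χ₀ 0             = refl
    χ₀ 1             = refl
    χ₀ (suc (suc d)) = refl

  -- The recurrence of the Stirling numbers.

  stirling₂≡partialPartitions : ∀ n k → stirling₂ n k ≡ partialPartitions n 0 k
  stirling₂≡partialPartitions n k = trans
    (length-filter-∑ (isPartition? k) (sublists (subsets n)))
    (∑-cong (sublists (subsets n)) λ P →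
      trans (𝟙-∧ (does (length P ≟ k)) _) (cong (𝟙 (does (length P ≟ k)) *_)
      (trans (𝟙-∧ (does (all? nonempty? P)) _) (cong (𝟙 (does (all? nonempty? P)) *_) (𝟙-exact? P)))))

  stirling₂-suc-zero : ∀ n → stirling₂ (suc n) 0 ≡ 0
  stirling₂-suc-zero n = trans (stirling₂≡partialPartitions (suc n) 0) (partialPartitions-suc-zero n 0)

  stirling₂-suc-suc : ∀ n k → stirling₂ (suc n) (suc k) ≡ stirling₂ n k + suc k * stirling₂ n (suc k)
  stirling₂-suc-suc n k
    rewrite stirling₂≡partialPartitions (suc n) (suc k)
          | stirling₂≡partialPartitions n k
          | stirling₂≡partialPartitions n (suc k)
    = trans (partialPartitions-suc-suc n 0 k) (partialPartitions-suc-m n 0 k)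

  stirling₂-< : ∀ n k → n < k → stirling₂ n k ≡ 0
  stirling₂-< zero    (suc k) _         =
    trans (stirling₂≡partialPartitions 0 (suc k)) (partialPartitions-zero-suc 0 k)
  stirling₂-< (suc n) (suc k) (s≤s n<k) = trans (stirling₂-suc-suc n k)
    (cong₂ _+_ (stirling₂-< n k n<k)
      (trans (cong (suc k *_) (stirling₂-< n (suc k) (m<n⇒m<1+n n<k))) (*-zeroʳ (suc k))))

open Stirling using (stirling₂-suc-zero; stirling₂-suc-suc; stirling₂-<)

-- Formal power series over a commutative ring

private
  variable
    c ℓ : Level

module _ (M : Monoid c ℓ) where
  open Monoid M

  sumFromTo-cong : ∀ n {f g : ℕ → Carrier} → (∀ k → f k ≈ g k) →
                   sumFromTo rawMonoid 0 n f ≈ sumFromTo rawMonoid 0 n g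
  sumFromTo-cong n f≈g = MonoidSum.sum-cong-≋ M {suc n} (f≈g ∘ toℕ)

  sumFromTo-sucʳ : ∀ n (f : ℕ → Carrier) →
                   sumFromTo rawMonoid 0 (suc n) f ≈ sumFromTo rawMonoid 0 n f ∙ f (suc n)
  sumFromTo-sucʳ zero    f = trans (∙-congˡ (identityʳ _)) (∙-congʳ (sym (identityʳ _)))
  sumFromTo-sucʳ (suc n) f = trans (∙-congˡ (sumFromTo-sucʳ n (f ∘ suc))) (sym (assoc _ _ _))

module _ (R : CommutativeRing c ℓ) where
  open CommutativeRing R
  open SemiringMult semiring
  open SemiringExp semiring using (_^_)

  -- Powers of a root of z² = z + 1 obey the Lucas recurrence, hence so does the sum of powers of
  -- two roots; `x + y ≈ 1#` supplies the initial value at 1.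
  lucas-binet : ∀ {x y} → x + y ≈ 1# → x * x ≈ x + 1# → y * y ≈ y + 1# →
                ∀ m → lucas m × 1# ≈ x ^ m + y ^ m
  lucas-binet {x} {y} x+y x² y² zero          = +-congˡ (+-identityʳ 1#)
  lucas-binet {x} {y} x+y x² y² (suc zero)    = trans (+-identityʳ 1#) (trans (sym x+y)
    (+-cong (sym (*-identityʳ x)) (sym (*-identityʳ y))))
  lucas-binet {x} {y} x+y x² y² (suc (suc m)) = begin
    (lucas (suc m) ℕ.+ lucas m) × 1#                   ≈⟨ ×-homo-+ 1# (lucas (suc m)) (lucas m) ⟩
    lucas (suc m) × 1# + lucas m × 1#                  ≈⟨ +-cong (lucas-binet x+y x² y² (suc m)) (lucas-binet x+y x² y² m) ⟩
    (x ^ suc m + y ^ suc m) + (x ^ m + y ^ m)          ≈⟨ interchange _ _ _ _ ⟩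
    (x ^ suc m + x ^ m) + (y ^ suc m + y ^ m)          ≈⟨ +-cong (step x²) (step y²) ⟨
    x ^ suc (suc m) + y ^ suc (suc m)                  ∎
    where
    open SetoidReasoning setoid
    open CommutativeSemigroupProperties +-commutativeSemigroup using (interchange)
    step : ∀ {z} → z * z ≈ z + 1# → z ^ suc (suc m) ≈ z ^ suc m + z ^ m
    step {z} z² = begin
      z * (z * z ^ m)            ≈⟨ *-assoc z z (z ^ m) ⟨
      z * z * z ^ m              ≈⟨ *-congʳ z² ⟩
      (z + 1#) * z ^ m           ≈⟨ distribʳ (z ^ m) z 1# ⟩
      z * z ^ m + 1# * z ^ m     ≈⟨ +-congˡ (*-identityˡ (z ^ m)) ⟩
      z ^ suc m + z ^ m          ∎

  ×-sumFromTo : ∀ n (f : ℕ → ℕ) x →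
    sumFromTo ℕ.+-0-rawMonoid 0 n f × x ≈ sumFromTo +-rawMonoid 0 n (λ k → f k × x)
  ×-sumFromTo zero    f x = ×-homo-+ x (f 0) 0
  ×-sumFromTo (suc n) f x = trans (×-homo-+ x (f 0) _) (+-congˡ (×-sumFromTo n (f ∘ suc) x))

module PowerSeries (R : CommutativeRing c ℓ) where

  private
    module R where
      open CommutativeRing R public
      open SemiringMult semiring public
      open SemiringExp semiring public using (_^_)
      open CommutativeMonoidMult +-commutativeMonoid public using (×-distrib-+)
    module R-solver = RingSolver R.commutativeSemiring

  -- The ring of formal power series.

  Series : Set c
  Series = ℕ → R.Carrier

  private
    variable
      f g h f′ g′ : Series

  infix 4 _≋_
  _≋_ : Series → Series → Set ℓ
  f ≋ g = ∀ n → f n R.≈ g n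

  infixl 6 _⊕_
  _⊕_ : Series → Series → Series
  (f ⊕ g) n = f n R.+ g n

  infixr 8 _•_
  _•_ : R.Carrier → Series → Series
  (x • f) n = x R.* f n

  1ˢ : Series
  1ˢ zero    = R.1#
  1ˢ (suc n) = R.0#

  shift : Series → Series
  shift f n = f (suc n)

  -- Opaque, so that unification can read f and g off f ⊛ g.
  opaque
    infixl 7 _⊛_
    _⊛_ : Series → Series → Series
    (f ⊛ g) n = sumFromTo R.+-rawMonoid 0 n (λ k → f k R.* g (n ∸ k))

    ⊛-zero : ∀ f g → (f ⊛ g) 0 R.≈ f 0 R.* g 0
    ⊛-zero f g = R.+-identityʳ _

    -- Corresponds to writing `f` as `f 0` plus t times `shift f`. Together with `⊛-zero` it
    -- determines the product, so ring laws can be proved by induction on the degree.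
    ⊛-suc : ∀ f g n → (f ⊛ g) (suc n) R.≈ f 0 R.* g (suc n) R.+ (shift f ⊛ g) n
    ⊛-suc f g n = R.refl

    -- The bound serves `D-exp`, where a truncated exponential is known to agree with the full one
    -- up to degree `n`.
    ⊛-cong-≤ : ∀ n → (∀ k → k ≤ n → f k R.≈ f′ k) → (∀ k → k ≤ n → g k R.≈ g′ k) →
               (f ⊛ g) n R.≈ (f′ ⊛ g′) n
    ⊛-cong-≤ {f = f} {g = g} zero p q = R.+-congʳ (R.*-cong (p 0 z≤n) (q 0 z≤n))
    ⊛-cong-≤ {f = f} {g = g} (suc n) p q = R.+-cong (R.*-cong (p 0 z≤n) (q (suc n) ℕ.≤-refl))
      (⊛-cong-≤ n (λ k k≤n → p (suc k) (s≤s k≤n)) (λ k k≤n → q k (ℕ.m≤n⇒m≤1+n k≤n)))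

  ⊛-cong : f ≋ f′ → g ≋ g′ → f ⊛ g ≋ f′ ⊛ g′
  ⊛-cong p q n = ⊛-cong-≤ n (λ k _ → p k) (λ k _ → q k)

  ⊛-zeroˡ-≤ : ∀ n g → (∀ k → k ≤ n → f k R.≈ R.0#) → (f ⊛ g) n R.≈ R.0#
  ⊛-zeroˡ-≤ zero    g p = R.trans (⊛-zero _ g) (R.trans (R.*-congʳ (p 0 z≤n)) (R.zeroˡ _))
  ⊛-zeroˡ-≤ (suc n) g p = R.trans (⊛-suc _ g n) (R.trans
    (R.+-cong (R.trans (R.*-congʳ (p 0 z≤n)) (R.zeroˡ _))
              (⊛-zeroˡ-≤ n g (λ k k≤n → p (suc k) (s≤s k≤n))))
    (R.+-identityˡ _))

  ⊛-distribʳ : ∀ h f g → (f ⊕ g) ⊛ h ≋ f ⊛ h ⊕ g ⊛ h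
  ⊛-distribʳ h f g zero = begin
    ((f ⊕ g) ⊛ h) 0                      ≈⟨ ⊛-zero _ h ⟩
    (f 0 R.+ g 0) R.* h 0                ≈⟨ R.distribʳ _ _ _ ⟩
    f 0 R.* h 0 R.+ g 0 R.* h 0          ≈⟨ R.+-cong (⊛-zero f h) (⊛-zero g h) ⟨
    (f ⊛ h) 0 R.+ (g ⊛ h) 0              ∎
    where open SetoidReasoning R.setoid
  ⊛-distribʳ h f g (suc n) = begin
    ((f ⊕ g) ⊛ h) (suc n)
      ≈⟨ ⊛-suc _ h n ⟩
    (f 0 R.+ g 0) R.* h (suc n) R.+ ((shift f ⊕ shift g) ⊛ h) n
      ≈⟨ R.+-congˡ (⊛-distribʳ h (shift f) (shift g) n) ⟩
    (f 0 R.+ g 0) R.* h (suc n) R.+ ((shift f ⊛ h) n R.+ (shift g ⊛ h) n)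
      ≈⟨ solve 5 (λ x y z u v → (x :+ y) :* z :+ (u :+ v) := (x :* z :+ u) :+ (y :* z :+ v))
           R.refl _ _ _ _ _ ⟩
    (f 0 R.* h (suc n) R.+ (shift f ⊛ h) n) R.+ (g 0 R.* h (suc n) R.+ (shift g ⊛ h) n)
      ≈⟨ R.+-cong (⊛-suc f h n) (⊛-suc g h n) ⟨
    (f ⊛ h) (suc n) R.+ (g ⊛ h) (suc n) ∎
    where
    open SetoidReasoning R.setoid
    open R-solver

  -- The mirror image of `⊛-suc`; comparing the two gives commutativity.
  ⊛-sucʳ : ∀ f g n → (f ⊛ g) (suc n) R.≈ f (suc n) R.* g 0 R.+ (f ⊛ shift g) n
  ⊛-sucʳ f g zero = begin
    (f ⊛ g) 1                              ≈⟨ ⊛-suc f g 0 ⟩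
    f 0 R.* g 1 R.+ (shift f ⊛ g) 0        ≈⟨ R.+-congˡ (⊛-zero _ g) ⟩
    f 0 R.* g 1 R.+ f 1 R.* g 0            ≈⟨ R.+-comm _ _ ⟩
    f 1 R.* g 0 R.+ f 0 R.* g 1            ≈⟨ R.+-congˡ (⊛-zero f _) ⟨
    f 1 R.* g 0 R.+ (f ⊛ shift g) 0        ∎
    where open SetoidReasoning R.setoid
  ⊛-sucʳ f g (suc n) = begin
    (f ⊛ g) (2 ℕ.+ n)
      ≈⟨ ⊛-suc f g (suc n) ⟩
    f 0 R.* g (2 ℕ.+ n) R.+ (shift f ⊛ g) (suc n)
      ≈⟨ R.+-congˡ (⊛-sucʳ (shift f) g n) ⟩
    f 0 R.* g (2 ℕ.+ n) R.+ (f (2 ℕ.+ n) R.* g 0 R.+ (shift f ⊛ shift g) n)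
      ≈⟨ solve 3 (λ x y z → x :+ (y :+ z) := y :+ (x :+ z)) R.refl _ _ _ ⟩
    f (2 ℕ.+ n) R.* g 0 R.+ (f 0 R.* g (2 ℕ.+ n) R.+ (shift f ⊛ shift g) n)
      ≈⟨ R.+-congˡ (⊛-suc f (shift g) n) ⟨
    f (2 ℕ.+ n) R.* g 0 R.+ (f ⊛ shift g) (suc n) ∎
    where
    open SetoidReasoning R.setoid
    open R-solver

  ⊛-comm : ∀ f g → f ⊛ g ≋ g ⊛ f
  ⊛-comm f g zero    = R.trans (⊛-zero f g) (R.trans (R.*-comm _ _) (R.sym (⊛-zero g f)))
  ⊛-comm f g (suc n) = R.trans (⊛-suc f g n) (R.trans
    (R.+-cong (R.*-comm _ _) (⊛-comm (shift f) g n))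
    (R.sym (⊛-sucʳ g f n)))

  •-⊛ : ∀ x f g → (x • f) ⊛ g ≋ x • (f ⊛ g)
  •-⊛ x f g zero = R.trans (⊛-zero _ g) (R.trans (R.*-assoc _ _ _) (R.*-congˡ (R.sym (⊛-zero f g))))
  •-⊛ x f g (suc n) = begin
    ((x • f) ⊛ g) (suc n)                                  ≈⟨ ⊛-suc _ g n ⟩
    x R.* f 0 R.* g (suc n) R.+ ((x • shift f) ⊛ g) n
      ≈⟨ R.+-cong (R.*-assoc _ _ _) (•-⊛ x (shift f) g n) ⟩
    x R.* (f 0 R.* g (suc n)) R.+ x R.* (shift f ⊛ g) n    ≈⟨ R.distribˡ _ _ _ ⟨
    x R.* (f 0 R.* g (suc n) R.+ (shift f ⊛ g) n)          ≈⟨ R.*-congˡ (⊛-suc f g n) ⟨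
    x R.* (f ⊛ g) (suc n)                                  ∎
    where open SetoidReasoning R.setoid

  ⊛-• : ∀ x f g → f ⊛ (x • g) ≋ x • (f ⊛ g)
  ⊛-• x f g n = R.trans (⊛-comm f _ n) (R.trans (•-⊛ x g f n) (R.*-congˡ (⊛-comm g f n)))

  ⊛-assoc : ∀ f g h → (f ⊛ g) ⊛ h ≋ f ⊛ (g ⊛ h)
  ⊛-assoc f g h zero = begin
    ((f ⊛ g) ⊛ h) 0            ≈⟨ ⊛-zero _ h ⟩
    (f ⊛ g) 0 R.* h 0          ≈⟨ R.*-congʳ (⊛-zero f g) ⟩
    f 0 R.* g 0 R.* h 0        ≈⟨ R.*-assoc _ _ _ ⟩
    f 0 R.* (g 0 R.* h 0)      ≈⟨ R.*-congˡ (⊛-zero g h) ⟨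
    f 0 R.* (g ⊛ h) 0          ≈⟨ ⊛-zero f _ ⟨
    (f ⊛ (g ⊛ h)) 0            ∎
    where open SetoidReasoning R.setoid
  ⊛-assoc f g h (suc n) = begin
    ((f ⊛ g) ⊛ h) (suc n)
      ≈⟨ ⊛-suc _ h n ⟩
    (f ⊛ g) 0 R.* h (suc n) R.+ (shift (f ⊛ g) ⊛ h) n
      ≈⟨ R.+-cong (R.*-congʳ (⊛-zero f g)) (⊛-cong (⊛-suc f g) (λ _ → R.refl) n) ⟩
    f 0 R.* g 0 R.* h (suc n) R.+ ((f 0 • shift g ⊕ shift f ⊛ g) ⊛ h) n
      ≈⟨ R.+-congˡ (R.trans (⊛-distribʳ h _ _ n) (R.+-cong (•-⊛ _ _ h n) (⊛-assoc (shift f) g h n))) ⟩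
    f 0 R.* g 0 R.* h (suc n) R.+ (f 0 R.* (shift g ⊛ h) n R.+ (shift f ⊛ (g ⊛ h)) n)
      ≈⟨ solve 5 (λ x y z u v → x :* y :* z :+ (x :* u :+ v) := x :* (y :* z :+ u) :+ v)
           R.refl _ _ _ _ _ ⟩
    f 0 R.* (g 0 R.* h (suc n) R.+ (shift g ⊛ h) n) R.+ (shift f ⊛ (g ⊛ h)) n
      ≈⟨ R.+-congʳ (R.*-congˡ (⊛-suc g h n)) ⟨
    f 0 R.* (g ⊛ h) (suc n) R.+ (shift f ⊛ (g ⊛ h)) n
      ≈⟨ ⊛-suc f _ n ⟨
    (f ⊛ (g ⊛ h)) (suc n) ∎
    where
    open SetoidReasoning R.setoid
    open R-solver

  ⊛-identityˡ : ∀ f → 1ˢ ⊛ f ≋ f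
  ⊛-identityˡ f zero    = R.trans (⊛-zero 1ˢ f) (R.*-identityˡ _)
  ⊛-identityˡ f (suc n) = R.trans (⊛-suc 1ˢ f n) (R.trans
    (R.+-cong (R.*-identityˡ _) (⊛-zeroˡ-≤ n f (λ _ _ → R.refl)))
    (R.+-identityʳ _))

  series : CommutativeRing c ℓ
  series = record
    { Carrier = Series
    ; _≈_ = _≋_
    ; _+_ = _⊕_
    ; _*_ = _⊛_
    ; -_ = λ f n → R.- f n
    ; 0# = λ n → R.0#
    ; 1# = 1ˢ
    ; isCommutativeRing = record
      { isRing = record
        { +-isAbelianGroup = Pointwise.isAbelianGroup ℕ R.+-isAbelianGroup
        ; *-cong = ⊛-cong
        ; *-assoc = ⊛-assoc
        ; *-identity = ⊛-identityˡ , λ f n → R.trans (⊛-comm f 1ˢ n) (⊛-identityˡ f n)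
        ; distrib = (λ f g h n → R.trans (⊛-comm f _ n) (R.trans (⊛-distribʳ f g h n)
                      (R.+-cong (⊛-comm g f n) (⊛-comm h f n))))
                  , ⊛-distribʳ
        }
      ; *-comm = ⊛-comm
      }
    }

  private
    module S where
      open CommutativeRing series public
      open SemiringMult semiring public
      open SemiringExp semiring public using (_^_)
      open CommutativeMonoidSum +-commutativeMonoid public using (∑-distrib-+)
      open CommutativeMonoidMult +-commutativeMonoid public using (×-distrib-+)

  -- Derivations and the Leibniz rule.

  ×-coeff : ∀ m f n → (m S.× f) n ≡ m R.× f n
  ×-coeff zero    f n = ≡.refl
  ×-coeff (suc m) f n = ≡.cong (f n R.+_) (×-coeff m f n)

  sum-coeff : ∀ m (F : ℕ → Series) n →
              sumFromTo S.+-rawMonoid 0 m F n ≡ sumFromTo R.+-rawMonoid 0 m (λ k → F k n)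
  sum-coeff zero    F n = ≡.refl
  sum-coeff (suc m) F n = ≡.cong (F 0 n R.+_) (sum-coeff m (F ∘ suc) n)

  -- `θ` is the Euler operator t d/dt, and `D f` is `shift (θ f)`. The Leibniz rule is proved first
  -- for `θ`: it preserves degrees, so on each product of coefficients the rule is just n = k + (n -
  -- k).
  θ D : Series → Series
  θ f n = n R.× f n
  D f n = suc n R.× f (suc n)

  D-cong : f ≋ g → D f ≋ D g
  D-cong p n = R.×-congʳ (suc n) (p (suc n))

  D-⊕ : ∀ f g → D (f ⊕ g) ≋ D f ⊕ D g
  D-⊕ f g n = R.×-distrib-+ _ _ (suc n)

  D-• : ∀ x f → D (x • f) ≋ x • D f
  D-• x f n = R.sym (R.×-comm-* (suc n) x _)

  D-0# : D S.0# ≋ S.0#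
  D-0# n = R.trans (R.sym (R.×-congʳ (suc n) (R.zeroˡ R.0#)))
    (R.trans (R.sym (R.×-comm-* (suc n) R.0# R.0#)) (R.zeroˡ _))

  D-1ˢ : D 1ˢ ≋ S.0#
  -- `D` ignores the constant term, and `1ˢ` agrees with `0#` in positive degrees.
  D-1ˢ = D-0#

  D-× : ∀ m f → D (m S.× f) ≋ m S.× D f
  D-× zero    f = D-0#
  D-× (suc m) f n = R.trans (D-⊕ f (m S.× f) n) (R.+-congˡ (D-× m f n))

  D-sum : ∀ m (F : ℕ → Series) → D (sumFromTo S.+-rawMonoid 0 m F) ≋ sumFromTo S.+-rawMonoid 0 m (D ∘ F)
  D-sum zero    F n = R.trans (D-⊕ (F 0) S.0# n) (R.+-congˡ (D-0# n))
  D-sum (suc m) F n = R.trans (D-⊕ (F 0) (sumFromTo S.+-rawMonoid 0 m (F ∘ suc)) n)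
    (R.+-congˡ (D-sum m (F ∘ suc) n))

  D^ : ℕ → Series → Series
  D^ zero    f = f
  D^ (suc r) f = D (D^ r f)

  -- The case of interest is `n = 0`, Taylor's formula for the coefficients. The induction trades
  -- one derivative for one degree, so it needs every `n`.
  taylor : ∀ (F : ℕ → Series) → (∀ r → D (F r) ≋ F (suc r)) →
           ∀ r n → (n !) R.× F r n R.≈ ((r ℕ.+ n) !) R.× F 0 (r ℕ.+ n)
  taylor F DF zero    n = R.refl
  taylor F DF (suc r) n = begin
    (n !) R.× F (suc r) n                          ≈⟨ R.×-congʳ (n !) (DF r n) ⟨
    (n !) R.× suc n R.× F r (suc n)                ≈⟨ R.×-assocˡ _ (n !) (suc n) ⟩
    (n ! ℕ.* suc n) R.× F r (suc n)                ≡⟨ ≡.cong (R._× F r (suc n)) (ℕ.*-comm (n !) (suc n)) ⟩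
    (suc n !) R.× F r (suc n)                      ≈⟨ taylor F DF r (suc n) ⟩
    ((r ℕ.+ suc n) !) R.× F 0 (r ℕ.+ suc n)        ≡⟨ ≡.cong (λ m → (m !) R.× F 0 m) (ℕ.+-suc r n) ⟩
    ((suc r ℕ.+ n) !) R.× F 0 (suc r ℕ.+ n)        ∎
    where open SetoidReasoning R.setoid

  θ-⊛ : ∀ f g → θ (f ⊛ g) ≋ θ f ⊛ g ⊕ f ⊛ θ g
  θ-⊛ f g zero = R.sym (begin
    (θ f ⊛ g) 0 R.+ (f ⊛ θ g) 0              ≈⟨ R.+-cong (⊛-zero (θ f) g) (⊛-zero f (θ g)) ⟩
    R.0# R.* g 0 R.+ f 0 R.* R.0#            ≈⟨ R.+-cong (R.zeroˡ _) (R.zeroʳ _) ⟩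
    R.0# R.+ R.0#                            ≈⟨ R.+-identityˡ _ ⟩
    R.0#                                     ∎)
    where open SetoidReasoning R.setoid
  θ-⊛ f g (suc n) = begin
    suc n R.× (f ⊛ g) (suc n)
      ≈⟨ R.×-congʳ (suc n) (⊛-suc f g n) ⟩
    suc n R.× (f 0 R.* g (suc n) R.+ (shift f ⊛ g) n)
      ≈⟨ R.×-distrib-+ _ _ (suc n) ⟩
    suc n R.× (f 0 R.* g (suc n)) R.+ ((shift f ⊛ g) n R.+ θ (shift f ⊛ g) n)
      ≈⟨ R.+-cong (R.sym (R.×-comm-* (suc n) _ _)) (R.+-congˡ (θ-⊛ (shift f) g n)) ⟩
    f 0 R.* θ g (suc n) R.+ ((shift f ⊛ g) n R.+ ((θ (shift f) ⊛ g) n R.+ (shift f ⊛ θ g) n))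
      -- The inserted zero is the constant term of `θ f` times `g (suc n)`. The extra
      -- `(shift f ⊛ g) n` makes up the difference between `θ (shift f)` and `shift (θ f)`.
      ≈⟨ solve 5 (λ x y z u v → x :+ (y :+ (z :+ u)) := (con 0 :* v :+ (y :+ z)) :+ (x :+ u))
           R.refl _ _ _ _ (g (suc n)) ⟩
    (R.0# R.* g (suc n) R.+ ((shift f ⊛ g) n R.+ (θ (shift f) ⊛ g) n))
      R.+ (f 0 R.* θ g (suc n) R.+ (shift f ⊛ θ g) n)
      ≈⟨ R.+-congʳ (R.+-congˡ (⊛-distribʳ g (shift f) (θ (shift f)) n)) ⟨
    (R.0# R.* g (suc n) R.+ (shift (θ f) ⊛ g) n) R.+ (f 0 R.* θ g (suc n) R.+ (shift f ⊛ θ g) n)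
      ≈⟨ R.+-cong (⊛-suc (θ f) g n) (⊛-suc f (θ g) n) ⟨
    (θ f ⊛ g) (suc n) R.+ (f ⊛ θ g) (suc n) ∎
    where
    open SetoidReasoning R.setoid
    open R-solver

  shift-θ-⊛ : ∀ f g → shift (θ f ⊛ g) ≋ D f ⊛ g
  shift-θ-⊛ f g n = R.trans (⊛-suc (θ f) g n) (R.trans (R.+-congʳ (R.zeroˡ _)) (R.+-identityˡ _))

  D-⊛ : ∀ f g → D (f ⊛ g) ≋ D f ⊛ g ⊕ f ⊛ D g
  D-⊛ f g n = begin
    θ (f ⊛ g) (suc n)                             ≈⟨ θ-⊛ f g (suc n) ⟩
    (θ f ⊛ g) (suc n) R.+ (f ⊛ θ g) (suc n)       ≈⟨ R.+-congˡ (⊛-comm f (θ g) (suc n)) ⟩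
    (θ f ⊛ g) (suc n) R.+ (θ g ⊛ f) (suc n)       ≈⟨ R.+-cong (shift-θ-⊛ f g n) (shift-θ-⊛ g f n) ⟩
    (D f ⊛ g) n R.+ (D g ⊛ f) n                   ≈⟨ R.+-congˡ (⊛-comm (D g) f n) ⟩
    (D f ⊛ g) n R.+ (f ⊛ D g) n                   ∎
    where open SetoidReasoning R.setoid

  D-^ : ∀ f k → D (f S.^ suc k) ≋ suc k S.× (D f ⊛ f S.^ k)
  D-^ f zero = begin
    D (f ⊛ 1ˢ)                      ≈⟨ D-⊛ f 1ˢ ⟩
    D f ⊛ 1ˢ ⊕ f ⊛ D 1ˢ             ≈⟨ S.+-congˡ (S.*-congˡ D-1ˢ) ⟩
    D f ⊛ 1ˢ ⊕ f ⊛ S.0#             ≈⟨ S.+-congˡ (S.zeroʳ f) ⟩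
    D f ⊛ 1ˢ ⊕ S.0#                 ∎
    where open SetoidReasoning S.setoid
  D-^ f (suc k) = begin
    D (f ⊛ f S.^ suc k)                                    ≈⟨ D-⊛ f _ ⟩
    D f ⊛ f S.^ suc k ⊕ f ⊛ D (f S.^ suc k)                ≈⟨ S.+-congˡ (S.*-congˡ (D-^ f k)) ⟩
    D f ⊛ f S.^ suc k ⊕ f ⊛ (suc k S.× (D f ⊛ f S.^ k))    ≈⟨ S.+-congˡ (S.×-comm-* (suc k) f _) ⟩
    D f ⊛ f S.^ suc k ⊕ suc k S.× (f ⊛ (D f ⊛ f S.^ k))
      ≈⟨ S.+-congˡ (S.×-congʳ (suc k) (S.trans (S.sym (S.*-assoc _ _ _))
           (S.trans (S.*-congʳ (S.*-comm _ _)) (S.*-assoc _ _ _)))) ⟩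
    D f ⊛ f S.^ suc k ⊕ suc k S.× (D f ⊛ f S.^ suc k)      ∎
    where open SetoidReasoning S.setoid

  -- Each factor `f` raises the order by at least one. This justifies cutting off the exponential
  -- series at `k = n` in degree `n`.
  ^-coeff : ∀ f → f 0 R.≈ R.0# → ∀ k n → n < k → (f S.^ k) n R.≈ R.0#
  ^-coeff f f₀ (suc k) zero    _         =
    R.trans (⊛-zero f _) (R.trans (R.*-congʳ f₀) (R.zeroˡ _))
  ^-coeff f f₀ (suc k) (suc n) (s≤s n<k) = R.trans (⊛-suc f _ n) (R.trans
    (R.+-cong (R.trans (R.*-congʳ f₀) (R.zeroˡ _))
      (R.trans (⊛-comm _ _ n) (⊛-zeroˡ-≤ n _ (λ j j≤n → ^-coeff f f₀ k j (ℕ.≤-<-trans j≤n n<k)))))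
    (R.+-identityˡ _))

  -- The exponential of a series without constant term.

  module Exponential
    (×-cancel : ∀ n .{{_ : NonZero n}} {x y} → n R.× x R.≈ n R.× y → x R.≈ y)
    (1/! : ℕ → R.Carrier)
    (!×1/! : ∀ n → (n !) R.× 1/! n R.≈ R.1#)
    where

    1/!-suc : ∀ n → suc n R.× 1/! (suc n) R.≈ 1/! n
    1/!-suc n = ×-cancel (n !) {{ℕ._!≢0 n}} (begin
      (n !) R.× suc n R.× 1/! (suc n)      ≈⟨ R.×-assocˡ _ (n !) (suc n) ⟩
      (n ! ℕ.* suc n) R.× 1/! (suc n)    ≡⟨ ≡.cong (R._× 1/! (suc n)) (ℕ.*-comm (n !) (suc n)) ⟩
      (suc n !) R.× 1/! (suc n)          ≈⟨ !×1/! (suc n) ⟩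
      R.1#                               ≈⟨ !×1/! n ⟨
      (n !) R.× 1/! n                      ∎)
      where open SetoidReasoning R.setoid

    exp : Series → Series
    exp f n = sumFromTo R.+-rawMonoid 0 n (λ k → 1/! k R.* (f S.^ k) n)

    -- In `exp` the cut-off depends on the degree, so it is not one finite sum of series. Here the
    -- cut-off is fixed, and the derivative can be taken term by term.
    partialExp : ℕ → Series → Series
    partialExp m f = sumFromTo S.+-rawMonoid 0 m (λ k → 1/! k • f S.^ k)

    partialExp-coeff : ∀ f → f 0 R.≈ R.0# → ∀ m n → partialExp (m ℕ.+ n) f n R.≈ exp f n
    partialExp-coeff f f₀ zero    n = R.reflexive (sum-coeff n (λ k → 1/! k • f S.^ k) n)
    partialExp-coeff f f₀ (suc m) n = begin
      partialExp (suc m ℕ.+ n) f n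
        ≈⟨ sumFromTo-sucʳ S.+-monoid (m ℕ.+ n) (λ k → 1/! k • f S.^ k) n ⟩
      partialExp (m ℕ.+ n) f n R.+ 1/! (suc m ℕ.+ n) R.* (f S.^ (suc m ℕ.+ n)) n
        ≈⟨ R.+-cong (partialExp-coeff f f₀ m n)
             (R.*-congˡ (^-coeff f f₀ (suc m ℕ.+ n) n (s≤s (ℕ.m≤n+m n m)))) ⟩
      exp f n R.+ 1/! (suc m ℕ.+ n) R.* R.0#   ≈⟨ R.+-congˡ (R.zeroʳ _) ⟩
      exp f n R.+ R.0#                         ≈⟨ R.+-identityʳ _ ⟩
      exp f n                                  ∎
      where open SetoidReasoning R.setoid

    D-partialExp : ∀ f m → D (partialExp (suc m) f) ≋ D f ⊛ partialExp m f
    D-partialExp f m = begin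
      D (partialExp (suc m) f)
        ≈⟨ D-sum (suc m) (λ k → 1/! k • f S.^ k) ⟩
      D (1/! 0 • 1ˢ) ⊕ sumFromTo S.+-rawMonoid 0 m (λ k → D (1/! (suc k) • f S.^ suc k))
        ≈⟨ S.+-cong (λ n → R.trans (D-• (1/! 0) 1ˢ n) (R.trans (R.*-congˡ (D-1ˢ n)) (R.zeroʳ _)))
             (sumFromTo-cong S.+-monoid m term) ⟩
      S.0# ⊕ sumFromTo S.+-rawMonoid 0 m (λ k → D f ⊛ (1/! k • f S.^ k))
        ≈⟨ S.+-identityˡ _ ⟩
      sumFromTo S.+-rawMonoid 0 m (λ k → D f ⊛ (1/! k • f S.^ k))
        ≈⟨ *-distribˡ-sum {suc m} (D f) (λ j → 1/! (toℕ j) • f S.^ toℕ j) ⟨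
      D f ⊛ partialExp m f ∎
      where
      open SetoidReasoning S.setoid
      open SemiringSum S.semiring using (*-distribˡ-sum)
      module ≈-R = SetoidReasoning R.setoid
      term : ∀ k → D (1/! (suc k) • f S.^ suc k) ≋ D f ⊛ (1/! k • f S.^ k)
      term k n = ≈-R.begin
        D (1/! (suc k) • f S.^ suc k) n                    ≈-R.≈⟨ D-• (1/! (suc k)) (f S.^ suc k) n ⟩
        1/! (suc k) R.* D (f S.^ suc k) n                  ≈-R.≈⟨ R.*-congˡ (D-^ f k n) ⟩
        1/! (suc k) R.* (suc k S.× (D f ⊛ f S.^ k)) n      ≈-R.≡⟨ ≡.cong (1/! (suc k) R.*_) (×-coeff (suc k) _ n) ⟩
        1/! (suc k) R.* (suc k R.× (D f ⊛ f S.^ k) n)      ≈-R.≈⟨ R.×-comm-* (suc k) _ _ ⟩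
        suc k R.× (1/! (suc k) R.* (D f ⊛ f S.^ k) n)      ≈-R.≈⟨ R.×-assoc-* (suc k) _ _ ⟨
        suc k R.× 1/! (suc k) R.* (D f ⊛ f S.^ k) n        ≈-R.≈⟨ R.*-congʳ (1/!-suc k) ⟩
        1/! k R.* (D f ⊛ f S.^ k) n                        ≈-R.≈⟨ ⊛-• (1/! k) (D f) (f S.^ k) n ⟨
        (D f ⊛ (1/! k • f S.^ k)) n                        ≈-R.∎

    D-exp : ∀ f → f 0 R.≈ R.0# → D (exp f) ≋ D f ⊛ exp f
    D-exp f f₀ n = begin
      -- Degree `n` of the derivative reads degree `suc n`, hence the cut-off at `suc n`;
      -- differentiation lowers it to `n`, which is still enough for the product in degree `n`.
      suc n R.× exp f (suc n)                  ≈⟨ R.×-congʳ (suc n) (partialExp-coeff f f₀ 0 (suc n)) ⟨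
      D (partialExp (suc n) f) n               ≈⟨ D-partialExp f n n ⟩
      (D f ⊛ partialExp n f) n                 ≈⟨ ⊛-cong-≤ n (λ _ _ → R.refl) agree ⟩
      (D f ⊛ exp f) n                          ∎
      where
      open SetoidReasoning R.setoid
      agree : ∀ k → k ≤ n → partialExp n f k R.≈ exp f k
      agree k k≤n = ≡.subst (λ m → partialExp m f k R.≈ exp f k) (ℕ.m∸n+n≡m k≤n)
        (partialExp-coeff f f₀ (n ∸ k) k)

    exp-zero : ∀ f → exp f 0 R.≈ R.1#
    exp-zero f = begin
      1/! 0 R.* R.1# R.+ R.0#      ≈⟨ R.+-identityʳ _ ⟩
      1/! 0 R.* R.1#               ≈⟨ R.*-identityʳ _ ⟩
      1/! 0                        ≈⟨ R.×-homo-1 _ ⟨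
      (0 !) R.× 1/! 0                ≈⟨ !×1/! 0 ⟩
      R.1#                         ∎
      where open SetoidReasoning R.setoid

    -- The equation determines each coefficient from the previous one. It stands in for the addition
    -- formula of the exponential, and with `m = 0` it gives exp 0 = 1.
    D-unique : ∀ m f g → D f ≋ m S.× f → D g ≋ m S.× g → f 0 R.≈ g 0 → f ≋ g
    D-unique m f g Df Dg f₀≈g₀ zero    = f₀≈g₀
    D-unique m f g Df Dg f₀≈g₀ (suc n) = ×-cancel (suc n) (begin
      suc n R.× f (suc n)        ≈⟨ Df n ⟩
      (m S.× f) n                ≡⟨ ×-coeff m f n ⟩
      m R.× f n                  ≈⟨ R.×-congʳ m (D-unique m f g Df Dg f₀≈g₀ n) ⟩
      m R.× g n                  ≡⟨ ×-coeff m g n ⟨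
      (m S.× g) n                ≈⟨ Dg n ⟨
      suc n R.× g (suc n)        ∎)
      where open SetoidReasoning R.setoid

    -- The series eⁱᵗ and exp (x (eᵗ - 1)).

    module Touchard (t : Series) (t₀ : t 0 R.≈ R.0#) (Dt : D t ≋ 1ˢ) where

      private
        ε : Series
        ε = exp t

      ×t-zero : ∀ i → (i S.× t) 0 R.≈ R.0#
      ×t-zero zero    = R.refl
      ×t-zero (suc i) = R.trans (R.+-cong t₀ (×t-zero i)) (R.+-identityˡ _)

      D-exp[×t] : ∀ i → D (exp (i S.× t)) ≋ i S.× exp (i S.× t)
      D-exp[×t] i = begin
        D (exp (i S.× t))                  ≈⟨ D-exp (i S.× t) (×t-zero i) ⟩
        D (i S.× t) ⊛ exp (i S.× t)        ≈⟨ S.*-congʳ (S.trans (D-× i t) (S.×-congʳ i Dt)) ⟩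
        (i S.× 1ˢ) ⊛ exp (i S.× t)         ≈⟨ S.×-assoc-* i 1ˢ _ ⟩
        i S.× (1ˢ ⊛ exp (i S.× t))         ≈⟨ S.×-congʳ i (S.*-identityˡ _) ⟩
        i S.× exp (i S.× t)                ∎
        where open SetoidReasoning S.setoid

      D-exp[t] : D ε ≋ ε
      D-exp[t] = S.trans (D-exp t t₀) (S.trans (S.*-congʳ Dt) (S.*-identityˡ _))

      exp[suc×t] : ∀ i → exp (suc i S.× t) ≋ ε ⊛ exp (i S.× t)
      exp[suc×t] i = D-unique (suc i) _ _ (D-exp[×t] (suc i)) product
        (R.trans (exp-zero (suc i S.× t)) (R.sym (R.trans (⊛-zero ε e)
          (R.trans (R.*-cong (exp-zero t) (exp-zero (i S.× t))) (R.*-identityˡ _)))))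
        where
        open SetoidReasoning S.setoid
        e = exp (i S.× t)
        product : D (ε ⊛ e) ≋ suc i S.× (ε ⊛ e)
        product = begin
          D (ε ⊛ e)                      ≈⟨ D-⊛ ε e ⟩
          D ε ⊛ e ⊕ ε ⊛ D e              ≈⟨ S.+-cong (S.*-congʳ D-exp[t]) (S.*-congˡ (D-exp[×t] i)) ⟩
          ε ⊛ e ⊕ ε ⊛ (i S.× e)          ≈⟨ S.+-congˡ (S.×-comm-* i ε e) ⟩
          ε ⊛ e ⊕ i S.× (ε ⊛ e)          ∎

      -- The exponential generating function of the Touchard polynomials Σₖ S(n,k) xᵏ.
      touchard : R.Carrier → Series
      touchard x = exp (x • (ε S.- 1ˢ))

      D-touchard : ∀ x → D (touchard x) ≋ ε ⊛ (x • touchard x)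
      D-touchard x = begin
        D F                            ≈⟨ D-exp (x • (ε S.- 1ˢ)) vanishes ⟩
        D (x • (ε S.- 1ˢ)) ⊛ F         ≈⟨ S.*-congʳ inner ⟩
        (x • ε) ⊛ F                    ≈⟨ •-⊛ x ε F ⟩
        x • (ε ⊛ F)                    ≈⟨ ⊛-• x ε F ⟨
        ε ⊛ (x • F)                    ∎
        where
        open SetoidReasoning S.setoid
        F = touchard x
        vanishes : x R.* (ε 0 R.- 1ˢ 0) R.≈ R.0#
        vanishes = R.trans (R.*-congˡ (R.trans (R.+-congʳ (exp-zero t)) (R.-‿inverseʳ R.1#))) (R.zeroʳ x)
        D-neg-1ˢ : D (S.- 1ˢ) ≋ S.0#
        D-neg-1ˢ n = R.trans (R.×-congʳ (suc n) -0#≈0#) (D-0# n)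
          where open RingProperties R.ring using (-0#≈0#)
        inner : D (x • (ε S.- 1ˢ)) ≋ x • ε
        inner n = R.trans (D-• x (ε S.- 1ˢ) n) (R.*-congˡ (R.trans (D-⊕ ε (S.- 1ˢ) n)
          (R.trans (R.+-cong (D-exp[t] n) (D-neg-1ˢ n)) (R.+-identityʳ _))))

      D-^•touchard : ∀ x i → D ((x R.^ i) • touchard x) ≋ ε ⊛ ((x R.^ suc i) • touchard x)
      D-^•touchard x i = begin
        D ((x R.^ i) • F)               ≈⟨ D-• (x R.^ i) F ⟩
        (x R.^ i) • D F                 ≈⟨ (λ n → R.*-congˡ (D-touchard x n)) ⟩
        (x R.^ i) • (ε ⊛ (x • F))       ≈⟨ ⊛-• (x R.^ i) ε (x • F) ⟨
        ε ⊛ ((x R.^ i) • x • F)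
          ≈⟨ S.*-congˡ (λ n → R.trans (R.sym (R.*-assoc _ _ _)) (R.*-congʳ (R.*-comm _ _))) ⟩
        ε ⊛ ((x R.^ suc i) • F)         ∎
        where
        open SetoidReasoning S.setoid
        F = touchard x

      -- The exponent `suc i` comes from the index k + 1 of the Lucas number in the definition of
      -- the Lucas-Fubini numbers.
      binet : R.Carrier → R.Carrier → ℕ → Series
      binet x y i = (x R.^ suc i) • touchard x ⊕ (y R.^ suc i) • touchard y

      D-binet : ∀ x y i → D (binet x y i) ≋ ε ⊛ binet x y (suc i)
      D-binet x y i = begin
        D (binet x y i)
          ≈⟨ D-⊕ ((x R.^ suc i) • touchard x) ((y R.^ suc i) • touchard y) ⟩
        D ((x R.^ suc i) • touchard x) ⊕ D ((y R.^ suc i) • touchard y)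
          ≈⟨ S.+-cong (D-^•touchard x (suc i)) (D-^•touchard y (suc i)) ⟩
        ε ⊛ ((x R.^ suc (suc i)) • touchard x) ⊕ ε ⊛ ((y R.^ suc (suc i)) • touchard y)
          ≈⟨ S.distribˡ ε _ _ ⟨
        ε ⊛ binet x y (suc i) ∎
        where open SetoidReasoning S.setoid

      binet-zero : ∀ x y i → binet x y i 0 R.≈ x R.^ suc i R.+ y R.^ suc i
      binet-zero x y i = R.+-cong (scaled x) (scaled y)
        where
        scaled : ∀ z → z R.^ suc i R.* touchard z 0 R.≈ z R.^ suc i
        scaled z = R.trans (R.*-congˡ (exp-zero (z • (ε S.- 1ˢ)))) (R.*-identityʳ _)

      -- Iterated derivatives and Stirling numbers.

      module IteratedDerivative
        (s : ℕ → ℕ → ℕ)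
        (s-zero-zero : s 0 0 ≡ 1)
        (s-suc-zero : ∀ n → s (suc n) 0 ≡ 0)
        (s-suc-suc : ∀ n k → s (suc n) (suc k) ≡ s n k ℕ.+ suc k ℕ.* s n (suc k))
        (s-< : ∀ n k → n < k → s n k ≡ 0)
        (G : ℕ → Series)
        (DG : ∀ i → D (G i) ≋ ε ⊛ G (suc i))
        where

        -- With u = eᵗ the hypothesis `DG` makes `G i` the i-th derivative of `G 0` with respect to
        -- u, and d/dt is u d/du. The sum is the classical expansion (u d/du)ʳ = Σ S(r,i) uⁱ
        -- (d/du)ⁱ, applied to `G 0`.
        derivative : ℕ → Series
        derivative r = sumFromTo S.+-rawMonoid 0 r (λ i → exp (i S.× t) ⊛ (s r i S.× G i))

        derivative-zero : derivative 0 ≋ G 0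
        derivative-zero = begin
          exp S.0# ⊛ (s 0 0 S.× G 0) ⊕ S.0#     ≈⟨ S.+-identityʳ _ ⟩
          exp S.0# ⊛ (s 0 0 S.× G 0)            ≈⟨ S.*-cong exp[0]≈1 (S.×-congˡ s-zero-zero) ⟩
          1ˢ ⊛ (1 S.× G 0)                      ≈⟨ S.*-identityˡ _ ⟩
          1 S.× G 0                             ≈⟨ S.×-homo-1 _ ⟩
          G 0                                   ∎
          where
          open SetoidReasoning S.setoid
          exp[0]≈1 : exp S.0# ≋ 1ˢ
          exp[0]≈1 = D-unique 0 _ _ (D-exp[×t] 0) D-1ˢ (exp-zero S.0#)

        D-derivative : ∀ r → D (derivative r) ≋ derivative (suc r)
        D-derivative r = begin
          D (derivative r)
            ≈⟨ D-sum r (λ i → exp (i S.× t) ⊛ (s r i S.× G i)) ⟩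
          Σ[ r ] (λ i → D (exp (i S.× t) ⊛ (s r i S.× G i)))
            ≈⟨ sumFromTo-cong S.+-monoid r term ⟩
          Σ[ r ] (λ i → A i ⊕ s r i S.× T (suc i))
            ≈⟨ S.∑-distrib-+ {suc r} (A ∘ toℕ) (λ j → s r (toℕ j) S.× T (suc (toℕ j))) ⟩
          Σ[ r ] A ⊕ Σ[ r ] (λ i → s r i S.× T (suc i))
            -- `A 0` vanishes through its factor 0 and `A (suc r)` because `s r (suc r)` is 0. After
            -- the shift both sums run over `T (suc i)`, and the recurrence of `s` combines them.
            ≈⟨ S.+-congʳ shift-A ⟩
          Σ[ r ] (A ∘ suc) ⊕ Σ[ r ] (λ i → s r i S.× T (suc i))
            ≈⟨ S.∑-distrib-+ {suc r} (A ∘ suc ∘ toℕ) (λ j → s r (toℕ j) S.× T (suc (toℕ j))) ⟨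
          Σ[ r ] (λ i → A (suc i) ⊕ s r i S.× T (suc i))
            ≈⟨ sumFromTo-cong S.+-monoid r term′ ⟩
          Σ[ r ] (λ i → exp (suc i S.× t) ⊛ (s (suc r) (suc i) S.× G (suc i)))
            ≈⟨ S.+-identityˡ _ ⟨
          S.0# ⊕ Σ[ r ] (λ i → exp (suc i S.× t) ⊛ (s (suc r) (suc i) S.× G (suc i)))
            ≈⟨ S.+-congʳ (S.trans (S.*-congˡ (S.×-congˡ (s-suc-zero r))) (S.zeroʳ _)) ⟨
          derivative (suc r) ∎
          where
          open SetoidReasoning S.setoid
          Σ[_] : ℕ → (ℕ → Series) → Series
          Σ[_] = sumFromTo S.+-rawMonoid 0
          T A : ℕ → Series
          T i = exp (i S.× t) ⊛ G i
          -- With the factor `i` in front, `A 0` computes to zero.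
          A i = (i ℕ.* s r i) S.× T i

          term : ∀ i → D (exp (i S.× t) ⊛ (s r i S.× G i)) ≋ A i ⊕ s r i S.× T (suc i)
          term i = begin
            D (e ⊛ (s r i S.× G i))
              ≈⟨ S.trans (D-cong (S.×-comm-* (s r i) e (G i))) (D-× (s r i) (e ⊛ G i)) ⟩
            s r i S.× D (e ⊛ G i)                      ≈⟨ S.×-congʳ (s r i) (D-⊛ e (G i)) ⟩
            s r i S.× (D e ⊛ G i ⊕ e ⊛ D (G i))        ≈⟨ S.×-congʳ (s r i) (S.+-cong left right) ⟩
            s r i S.× (i S.× T i ⊕ T (suc i))          ≈⟨ S.×-distrib-+ _ _ (s r i) ⟩
            s r i S.× i S.× T i ⊕ s r i S.× T (suc i)  ≈⟨ S.+-congʳ (S.×-assocˡ _ (s r i) i) ⟩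
            (s r i ℕ.* i) S.× T i ⊕ s r i S.× T (suc i)
              ≡⟨ ≡.cong (λ m → m S.× T i ⊕ s r i S.× T (suc i)) (ℕ.*-comm (s r i) i) ⟩
            A i ⊕ s r i S.× T (suc i)                  ∎
            where
            e = exp (i S.× t)
            left : D e ⊛ G i ≋ i S.× T i
            left = S.trans (S.*-congʳ (D-exp[×t] i)) (S.×-assoc-* i e (G i))
            right : e ⊛ D (G i) ≋ T (suc i)
            right = begin
              e ⊛ D (G i)             ≈⟨ S.*-congˡ (DG i) ⟩
              e ⊛ (ε ⊛ G (suc i))     ≈⟨ S.*-assoc _ _ _ ⟨
              (e ⊛ ε) ⊛ G (suc i)     ≈⟨ S.*-congʳ (S.trans (S.*-comm e ε) (S.sym (exp[suc×t] i))) ⟩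
              T (suc i)               ∎

          term′ : ∀ i → A (suc i) ⊕ s r i S.× T (suc i) ≋
                        exp (suc i S.× t) ⊛ (s (suc r) (suc i) S.× G (suc i))
          term′ i = begin
            A (suc i) ⊕ s r i S.× T (suc i)                          ≈⟨ S.+-comm _ _ ⟩
            s r i S.× T (suc i) ⊕ A (suc i)                          ≈⟨ S.×-homo-+ _ (s r i) _ ⟨
            (s r i ℕ.+ suc i ℕ.* s r (suc i)) S.× T (suc i)          ≈⟨ S.×-congˡ (s-suc-suc r i) ⟨
            s (suc r) (suc i) S.× T (suc i)                          ≈⟨ S.×-comm-* (s (suc r) (suc i)) _ _ ⟨
            exp (suc i S.× t) ⊛ (s (suc r) (suc i) S.× G (suc i))    ∎

          shift-A : Σ[ r ] A ≋ Σ[ r ] (A ∘ suc)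
          shift-A = begin
            Σ[ r ] A                      ≈⟨ S.+-identityʳ _ ⟨
            Σ[ r ] A ⊕ S.0#
              ≈⟨ S.+-congˡ (S.×-congˡ {x = T (suc r)}
                   (≡.trans (≡.cong (suc r ℕ.*_) (s-< r (suc r) ℕ.≤-refl)) (ℕ.*-zeroʳ r))) ⟨
            Σ[ r ] A ⊕ A (suc r)          ≈⟨ sumFromTo-sucʳ S.+-monoid r A ⟨
            A 0 ⊕ Σ[ r ] (A ∘ suc)        ≈⟨ S.+-identityˡ _ ⟩
            Σ[ r ] (A ∘ suc)              ∎

        coeff-G₀ : ∀ r → (r !) R.× G 0 r R.≈ sumFromTo R.+-rawMonoid 0 r (λ i → s r i R.× G i 0)
        coeff-G₀ r = begin
          (r !) R.× G 0 r                      ≈⟨ R.×-congʳ (r !) (derivative-zero r) ⟨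
          (r !) R.× derivative 0 r             ≡⟨ ≡.cong (λ m → (m !) R.× derivative 0 m) (ℕ.+-identityʳ r) ⟨
          ((r ℕ.+ 0) !) R.× derivative 0 (r ℕ.+ 0)    ≈⟨ taylor derivative D-derivative r 0 ⟨
          1 R.× derivative r 0                 ≈⟨ R.×-homo-1 _ ⟩
          derivative r 0                       ≡⟨ sum-coeff r (λ i → exp (i S.× t) ⊛ (s r i S.× G i)) 0 ⟩
          sumFromTo R.+-rawMonoid 0 r (λ i → (exp (i S.× t) ⊛ (s r i S.× G i)) 0)
            ≈⟨ sumFromTo-cong R.+-monoid r term ⟩
          sumFromTo R.+-rawMonoid 0 r (λ i → s r i R.× G i 0) ∎
          where
          open SetoidReasoning R.setoid
          term : ∀ i → (exp (i S.× t) ⊛ (s r i S.× G i)) 0 R.≈ s r i R.× G i 0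
          term i = begin
            (exp (i S.× t) ⊛ (s r i S.× G i)) 0      ≈⟨ ⊛-zero _ _ ⟩
            exp (i S.× t) 0 R.* (s r i S.× G i) 0    ≈⟨ R.*-congʳ (exp-zero (i S.× t)) ⟩
            R.1# R.* (s r i S.× G i) 0               ≈⟨ R.*-identityˡ _ ⟩
            (s r i S.× G i) 0                        ≡⟨ ×-coeff (s r i) (G i) 0 ⟩
            s r i R.× G i 0                          ∎

      -- Identification of the Lucas-Fubini series.

      module _
        (x y : R.Carrier)
        (x+y≈1 : x R.+ y R.≈ R.1#) (x²≈x+1 : x R.* x R.≈ x R.+ R.1#) (y²≈y+1 : y R.* y R.≈ y R.+ R.1#)
        (L : Series)
        (coeff-L : ∀ n → (n !) R.× L n R.≈ lucasFubini n R.× R.1#)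
        where

        open IteratedDerivative stirling₂ ≡.refl stirling₂-suc-zero stirling₂-suc-suc stirling₂-<
          (binet x y) (D-binet x y)

        binet₀-coeff : ∀ n → (n !) R.× binet x y 0 n R.≈ lucasFubini n R.× R.1#
        binet₀-coeff n = begin
          (n !) R.× binet x y 0 n
            ≈⟨ coeff-G₀ n ⟩
          sumFromTo R.+-rawMonoid 0 n (λ k → stirling₂ n k R.× binet x y k 0)
            ≈⟨ sumFromTo-cong R.+-monoid n term ⟩
          sumFromTo R.+-rawMonoid 0 n (λ k → (lucas (suc k) ℕ.* stirling₂ n k) R.× R.1#)
            ≈⟨ ×-sumFromTo R n (λ k → lucas (suc k) ℕ.* stirling₂ n k) R.1# ⟨
          lucasFubini n R.× R.1# ∎
          where
          open SetoidReasoning R.setoid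
          term : ∀ k → stirling₂ n k R.× binet x y k 0 R.≈ (lucas (suc k) ℕ.* stirling₂ n k) R.× R.1#
          term k = begin
            stirling₂ n k R.× binet x y k 0                     ≈⟨ R.×-congʳ (stirling₂ n k) (binet-zero x y k) ⟩
            stirling₂ n k R.× (x R.^ suc k R.+ y R.^ suc k)
              ≈⟨ R.×-congʳ (stirling₂ n k) (lucas-binet R x+y≈1 x²≈x+1 y²≈y+1 (suc k)) ⟨
            stirling₂ n k R.× lucas (suc k) R.× R.1#            ≈⟨ R.×-assocˡ R.1# (stirling₂ n k) (lucas (suc k)) ⟩
            (stirling₂ n k ℕ.* lucas (suc k)) R.× R.1#          ≡⟨ ≡.cong (R._× R.1#) (ℕ.*-comm (stirling₂ n k) (lucas (suc k))) ⟩
            (lucas (suc k) ℕ.* stirling₂ n k) R.× R.1#          ∎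

        D^-L≋derivative : ∀ r → D^ r L ≋ derivative r
        D^-L≋derivative zero    n = R.trans
          (×-cancel (n !) {{n ℕ.!≢0}} (R.trans (coeff-L n) (R.sym (binet₀-coeff n))))
          (R.sym (derivative-zero n))
        D^-L≋derivative (suc r) = S.trans (D-cong (D^-L≋derivative r)) (D-derivative r)

        D^-L : ∀ r → D^ (suc r) L ≋
          sumFromTo S.+-rawMonoid 1 (suc r) (λ i → exp (i S.× t) ⊛ (stirling₂ (suc r) i S.× binet x y i))
        D^-L r = S.trans (D^-L≋derivative (suc r))
          -- The term of index 0 drops out because S(r + 1, 0) = 0, so the sum may start at 1.
          (S.trans (S.+-congʳ (S.trans (S.*-congˡ (S.×-congˡ (stirling₂-suc-zero r))) (S.zeroʳ _)))
            (S.+-identityˡ _))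

-- The field ℚ(√5)

open import Defs
open import Data.Integer.Base using (+_)
import Data.Integer.Solver as ℤ-Solver
open import Data.Rational.Base as ℚ using (0ℚ; 1ℚ; _/_)
import Data.Rational.Properties as ℚ
import Data.Rational.Solver as ℚ-Solver
open import Data.Rational.Unnormalised.Base as ℚᵘ using (mkℚᵘ; *≡*)
import Data.Rational.Unnormalised.Properties as ℚᵘ
open import Relation.Binary.PropositionalEquality

ℚ√5-commutativeRing : CommutativeRing 0ℓ 0ℓ
ℚ√5-commutativeRing = record
  { Carrier = ℚ√5
  ; _≈_ = _≡_
  ; _+_ = Scalar._+_
  ; _*_ = Scalar._*_
  ; -_ = Scalar.-_
  ; 0# = Scalar.0#
  ; 1# = Scalar.1#
  ; isCommutativeRing = record
    { isRing = record
      { +-isAbelianGroup = record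
        { isGroup = record
          { isMonoid = record
            { isSemigroup = record
              { isMagma = record { isEquivalence = isEquivalence ; ∙-cong = cong₂ Scalar._+_ }
              ; assoc = λ { ⟨ a , b ⟩ ⟨ c , d ⟩ ⟨ e , f ⟩ → cong₂ ⟨_,_⟩ (ℚ.+-assoc a c e) (ℚ.+-assoc b d f) }
              }
            ; identity = (λ { ⟨ a , b ⟩ → cong₂ ⟨_,_⟩ (ℚ.+-identityˡ a) (ℚ.+-identityˡ b) })
                       , (λ { ⟨ a , b ⟩ → cong₂ ⟨_,_⟩ (ℚ.+-identityʳ a) (ℚ.+-identityʳ b) })
            }
          ; inverse = (λ { ⟨ a , b ⟩ → cong₂ ⟨_,_⟩ (ℚ.+-inverseˡ a) (ℚ.+-inverseˡ b) })
                    , (λ { ⟨ a , b ⟩ → cong₂ ⟨_,_⟩ (ℚ.+-inverseʳ a) (ℚ.+-inverseʳ b) })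
          ; ⁻¹-cong = cong Scalar.-_
          }
        ; comm = λ { ⟨ a , b ⟩ ⟨ c , d ⟩ → cong₂ ⟨_,_⟩ (ℚ.+-comm a c) (ℚ.+-comm b d) }
        }
      ; *-cong = cong₂ Scalar._*_
      ; *-assoc = λ { ⟨ a , b ⟩ ⟨ c , d ⟩ ⟨ e , f ⟩ → cong₂ ⟨_,_⟩
          -- The constant 5 is generalised to a variable `k`: associativity is a polynomial identity
          -- for any adjoined square root.
          (solve 7 (λ k a b c d e f →
            (a :* c :+ k :* (b :* d)) :* e :+ k :* ((a :* d :+ b :* c) :* f) :=
            a :* (c :* e :+ k :* (d :* f)) :+ k :* (b :* (c :* f :+ d :* e))) refl (+ 5 / 1) a b c d e f)
          (solve 7 (λ k a b c d e f →
            (a :* c :+ k :* (b :* d)) :* f :+ (a :* d :+ b :* c) :* e :=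
            a :* (c :* f :+ d :* e) :+ b :* (c :* e :+ k :* (d :* f))) refl (+ 5 / 1) a b c d e f) }
      ; *-identity =
          (λ { ⟨ a , b ⟩ → cong₂ ⟨_,_⟩
            (solve 3 (λ k a b → con 1ℚ :* a :+ k :* (con 0ℚ :* b) := a) refl (+ 5 / 1) a b)
            (solve 2 (λ a b → con 1ℚ :* b :+ con 0ℚ :* a := b) refl a b) })
        , (λ { ⟨ a , b ⟩ → cong₂ ⟨_,_⟩
            (solve 3 (λ k a b → a :* con 1ℚ :+ k :* (b :* con 0ℚ) := a) refl (+ 5 / 1) a b)
            (solve 2 (λ a b → a :* con 0ℚ :+ b :* con 1ℚ := b) refl a b) })
      ; distrib =
          (λ { ⟨ a , b ⟩ ⟨ c , d ⟩ ⟨ e , f ⟩ → cong₂ ⟨_,_⟩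
            (solve 7 (λ k a b c d e f →
              a :* (c :+ e) :+ k :* (b :* (d :+ f)) :=
              (a :* c :+ k :* (b :* d)) :+ (a :* e :+ k :* (b :* f))) refl (+ 5 / 1) a b c d e f)
            (solve 6 (λ a b c d e f →
              a :* (d :+ f) :+ b :* (c :+ e) :=
              (a :* d :+ b :* c) :+ (a :* f :+ b :* e)) refl a b c d e f) })
        , (λ { ⟨ a , b ⟩ ⟨ c , d ⟩ ⟨ e , f ⟩ → cong₂ ⟨_,_⟩
            (solve 7 (λ k a b c d e f →
              (c :+ e) :* a :+ k :* ((d :+ f) :* b) :=
              (c :* a :+ k :* (d :* b)) :+ (e :* a :+ k :* (f :* b))) refl (+ 5 / 1) a b c d e f)
            (solve 6 (λ a b c d e f →
              (c :+ e) :* b :+ (d :+ f) :* a :=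
              (c :* b :+ d :* a) :+ (e :* b :+ f :* a)) refl a b c d e f) })
      }
    ; *-comm = λ { ⟨ a , b ⟩ ⟨ c , d ⟩ → cong₂ ⟨_,_⟩
        (solve 5 (λ k a b c d → a :* c :+ k :* (b :* d) := c :* a :+ k :* (d :* b)) refl (+ 5 / 1) a b c d)
        (solve 4 (λ a b c d → a :* d :+ b :* c := c :* b :+ d :* a) refl a b c d) }
    }
  }
  where open ℚ-Solver.+-*-Solver

-- Reduction of `a / n` to lowest terms does not compute for variables, so the equation is
-- cross-multiplied among unnormalised fractions.
/-cancel : ∀ a n .{{_ : NonZero n}} → (+ n / 1) ℚ.* (a / n) ≡ a / 1
/-cancel a n@(suc m) = ℚ.toℚᵘ-injective (begin
  ℚ.toℚᵘ ((+ n / 1) ℚ.* (a / n))           ≈⟨ ℚ.toℚᵘ-homo-* (+ n / 1) (a / n) ⟩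
  ℚ.toℚᵘ (+ n / 1) ℚᵘ.* ℚ.toℚᵘ (a / n)
    ≈⟨ ℚᵘ.*-cong (ℚ.toℚᵘ-fromℚᵘ (mkℚᵘ (+ n) 0)) (ℚ.toℚᵘ-fromℚᵘ (mkℚᵘ a m)) ⟩
  mkℚᵘ (+ n) 0 ℚᵘ.* mkℚᵘ a m
    ≈⟨ *≡* (solve 2 (λ x y → x :* y :* con (+ 1) := y :* (con (+ 1) :* x)) refl (+ n) a) ⟩
  mkℚᵘ a 0                                 ≈⟨ ℚ.toℚᵘ-fromℚᵘ (mkℚᵘ a 0) ⟨
  ℚ.toℚᵘ (a / 1)                           ∎)
  where
  open SetoidReasoning ℚᵘ.≃-setoid
  open ℤ-Solver.+-*-Solver

1+n/1 : ∀ n → 1ℚ ℚ.+ (+ n / 1) ≡ + suc n / 1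
1+n/1 n = ℚ.toℚᵘ-injective (begin
  ℚ.toℚᵘ (1ℚ ℚ.+ (+ n / 1))                ≈⟨ ℚ.toℚᵘ-homo-+ 1ℚ (+ n / 1) ⟩
  ℚ.toℚᵘ 1ℚ ℚᵘ.+ ℚ.toℚᵘ (+ n / 1)          ≈⟨ ℚᵘ.+-congʳ (ℚ.toℚᵘ 1ℚ) (ℚ.toℚᵘ-fromℚᵘ (mkℚᵘ (+ n) 0)) ⟩
  mkℚᵘ (+ 1) 0 ℚᵘ.+ mkℚᵘ (+ n) 0
    ≈⟨ *≡* (solve 1 (λ x → (con (+ 1) :* con (+ 1) :+ x :* con (+ 1)) :* con (+ 1) :=
                           (con (+ 1) :+ x) :* con (+ 1)) refl (+ n)) ⟩
  mkℚᵘ (+ suc n) 0                         ≈⟨ ℚ.toℚᵘ-fromℚᵘ (mkℚᵘ (+ suc n) 0) ⟨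
  ℚ.toℚᵘ (+ suc n / 1)                     ∎)
  where
  open SetoidReasoning ℚᵘ.≃-setoid
  open ℤ-Solver.+-*-Solver

private
  module K where
    open CommutativeRing ℚ√5-commutativeRing public
    open SemiringMult semiring public

fromℚ-* : ∀ p q → fromℚ p Scalar.* fromℚ q ≡ fromℚ (p ℚ.* q)
fromℚ-* p q = cong₂ ⟨_,_⟩
  (solve 3 (λ k p q → p :* q :+ k :* (con 0ℚ :* con 0ℚ) := p :* q) refl (+ 5 / 1) p q)
  (solve 2 (λ p q → p :* con 0ℚ :+ con 0ℚ :* q := con 0ℚ) refl p q)
  where open ℚ-Solver.+-*-Solver

×1#≡fromℚ : ∀ n → n Scalar.×ⁿ Scalar.1# ≡ fromℚ (+ n / 1)
×1#≡fromℚ zero    = refl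
×1#≡fromℚ (suc n) = trans (cong (Scalar.1# Scalar.+_) (×1#≡fromℚ n))
  (cong₂ ⟨_,_⟩ (1+n/1 n) refl)

×≡fromℚ* : ∀ n x → n Scalar.×ⁿ x ≡ fromℚ (+ n / 1) Scalar.* x
×≡fromℚ* n x = begin
  n Scalar.×ⁿ x                          ≡⟨ cong (n Scalar.×ⁿ_) (K.*-identityˡ x) ⟨
  n Scalar.×ⁿ (Scalar.1# Scalar.* x)     ≡⟨ K.×-assoc-* n Scalar.1# x ⟨
  (n Scalar.×ⁿ Scalar.1#) Scalar.* x     ≡⟨ cong (Scalar._* x) (×1#≡fromℚ n) ⟩
  fromℚ (+ n / 1) Scalar.* x             ∎
  where open ≡-Reasoning

×-fromℚ-/ : ∀ a n .{{_ : NonZero n}} → n Scalar.×ⁿ fromℚ (+ a / n) ≡ a Scalar.×ⁿ Scalar.1#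
×-fromℚ-/ a n = begin
  n Scalar.×ⁿ fromℚ (+ a / n)                    ≡⟨ ×≡fromℚ* n _ ⟩
  fromℚ (+ n / 1) Scalar.* fromℚ (+ a / n)       ≡⟨ fromℚ-* (+ n / 1) (+ a / n) ⟩
  fromℚ ((+ n / 1) ℚ.* (+ a / n))                ≡⟨ cong fromℚ (/-cancel (+ a) n) ⟩
  fromℚ (+ a / 1)                                ≡⟨ ×1#≡fromℚ a ⟨
  a Scalar.×ⁿ Scalar.1#                          ∎
  where open ≡-Reasoning

×-cancel : ∀ n .{{_ : NonZero n}} {x y} → n Scalar.×ⁿ x ≡ n Scalar.×ⁿ y → x ≡ y
×-cancel n {x} {y} eq = trans (sym (recover x)) (trans (cong (fromℚ (+ 1 / n) Scalar.*_) eq) (recover y))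
  where
  open ≡-Reasoning
  recover : ∀ z → fromℚ (+ 1 / n) Scalar.* (n Scalar.×ⁿ z) ≡ z
  recover z = begin
    fromℚ (+ 1 / n) Scalar.* (n Scalar.×ⁿ z)      ≡⟨ K.×-comm-* n (fromℚ (+ 1 / n)) z ⟩
    n Scalar.×ⁿ (fromℚ (+ 1 / n) Scalar.* z)      ≡⟨ K.×-assoc-* n (fromℚ (+ 1 / n)) z ⟨
    (n Scalar.×ⁿ fromℚ (+ 1 / n)) Scalar.* z      ≡⟨ cong (Scalar._* z) (×-fromℚ-/ 1 n) ⟩
    (1 Scalar.×ⁿ Scalar.1#) Scalar.* z            ≡⟨ cong (Scalar._* z) (K.×-homo-1 Scalar.1#) ⟩
    Scalar.1# Scalar.* z                          ≡⟨ K.*-identityˡ z ⟩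
    z                                             ∎

-- Specialisation to ℚ(√5) and comparison with the series of the statement.

private
  module P = PowerSeries ℚ√5-commutativeRing
  module E = P.Exponential ×-cancel (egf (λ _ → 1)) (λ n → ×-fromℚ-/ 1 (n !) {{n ℕ.!≢0}})
  module S where
    open CommutativeRing P.series public
    open SemiringMult semiring public
    open SemiringExp semiring public using (_^_)
  open P using (_⊛_; D^)

∂t≈1ˢ : ∂ t ≈ P.1ˢ
∂t≈1ˢ zero    = refl
∂t≈1ˢ (suc n) = P.D-0# (suc n)

private
  module T = E.Touchard t refl ∂t≈1ˢ

-- The operations of Defs agree with those of PowerSeries almost by definition.  They are
-- nevertheless compared one at a time, with explicit arguments: the type checker would
-- compare larger terms by unfolding them into rational arithmetic.

1ˢ≈1# : P.1ˢ ≈ 1#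
1ˢ≈1# zero    = refl
1ˢ≈1# (suc n) = refl

opaque
  unfolding _⊛_

  ⊛≈* : ∀ f f′ g g′ → f ≈ f′ → g ≈ g′ → f ⊛ g ≈ f′ * g′
  ⊛≈* f f′ g g′ f≈f′ g≈g′ n = sumFromTo-cong K.+-monoid n
    {λ k → f k Scalar.* g (n ∸ k)} {λ k → f′ k Scalar.* g′ (n ∸ k)}
    (λ k → cong₂ Scalar._*_ (f≈f′ k) (g≈g′ (n ∸ k)))

^≈^ : ∀ f f′ → f ≈ f′ → ∀ k → f S.^ k ≈ f′ ^ k
^≈^ f f′ f≈f′ zero    = 1ˢ≈1#
^≈^ f f′ f≈f′ (suc k) = ⊛≈* f f′ (f S.^ k) (f′ ^ k) f≈f′ (^≈^ f f′ f≈f′ k)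

×≈× : ∀ m f f′ → f ≈ f′ → m S.× f ≈ m ×ⁿ f′
×≈× zero    f f′ f≈f′ n = refl
×≈× (suc m) f f′ f≈f′ n = cong₂ Scalar._+_ (f≈f′ n) (×≈× m f f′ f≈f′ n)

sumFromTo≈∑ : ∀ r (F F′ : ℕ → Series) → (∀ i → F i ≈ F′ i) →
              sumFromTo S.+-rawMonoid 1 (suc r) F ≈ ∑[ 1 ⋯ suc r ] F′
sumFromTo≈∑ zero    F F′ F≈F′ n = cong (Scalar._+ Scalar.0#) (F≈F′ 1 n)
sumFromTo≈∑ (suc r) F F′ F≈F′ n =
  cong₂ Scalar._+_ (F≈F′ 1 n) (sumFromTo≈∑ r (F ∘ suc) (F′ ∘ suc) (F≈F′ ∘ suc) n)

exp≈exp : ∀ f f′ → f ≈ f′ → E.exp f ≈ exp f′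
exp≈exp f f′ f≈f′ n = sumFromTo-cong K.+-monoid n
  {λ k → egf (λ _ → 1) k Scalar.* (f S.^ k) n} {λ k → egf (λ _ → 1) k Scalar.* (f′ ^ k) n}
  (λ k → cong (egf (λ _ → 1) k Scalar.*_) (^≈^ f f′ f≈f′ k n))

∂^≡D^ : ∀ r f → ∂^ r f ≡ D^ r f
∂^≡D^ zero    f = refl
∂^≡D^ (suc r) f = cong ∂ (∂^≡D^ r f)

touchard≈exp : ∀ x → T.touchard x ≈ exp (x • (exp t - 1#))
touchard≈exp x = exp≈exp (x • (E.exp t - P.1ˢ)) (x • (exp t - 1#))
  (λ n → cong₂ (λ y z → x Scalar.* (y Scalar.+ Scalar.- z)) (exp≈exp t t (λ _ → refl) n) (1ˢ≈1# n))

binetSeries : ℕ → Series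
binetSeries i =
  (α Scalar.^ suc i) • exp (α • (exp t - 1#)) + (β Scalar.^ suc i) • exp (β • (exp t - 1#))

binet≈binetSeries : ∀ i → T.binet α β i ≈ binetSeries i
binet≈binetSeries i n = cong₂ Scalar._+_
  (cong (α Scalar.^ suc i Scalar.*_) (touchard≈exp α n))
  (cong (β Scalar.^ suc i Scalar.*_) (touchard≈exp β n))

D^-𝖫 : ∀ r → D^ (suc r) 𝖫 ≈
  sumFromTo S.+-rawMonoid 1 (suc r) (λ i → E.exp (i S.× t) ⊛ (stirling₂ (suc r) i S.× T.binet α β i))
-- The three `refl` are α + β = 1, α² = α + 1 and β² = β + 1, checked by evaluating closed pairs of
-- rationals.
D^-𝖫 = T.D^-L α β refl refl refl 𝖫 (λ n → ×-fromℚ-/ (lucasFubini n) (n !) {{n ℕ.!≢0}})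

theorem8 : (r : ℕ) → r ≥ 1 →
    ∂^ r 𝖫 ≈ ∑[ 1 ⋯ r ] (λ i →
    exp (i ×ⁿ t) * (stirling₂ r i ×ⁿ
    ( (α Scalar.^ suc i) • exp (α • (exp t - 1#))
    + (β Scalar.^ suc i) • exp (β • (exp t - 1#)) )))
theorem8 (suc r) _ = subst (_≈ ∑[ 1 ⋯ suc r ] F′) (sym (∂^≡D^ (suc r) 𝖫))
  (S.trans {D^ (suc r) 𝖫} {sumFromTo S.+-rawMonoid 1 (suc r) F} {∑[ 1 ⋯ suc r ] F′}
    (D^-𝖫 r) (sumFromTo≈∑ r F F′ F≈F′))
  where
  F F′ : ℕ → Series
  F i  = E.exp (i S.× t) ⊛ (stirling₂ (suc r) i S.× T.binet α β i)
  F′ i = exp (i ×ⁿ t) * (stirling₂ (suc r) i ×ⁿ binetSeries i)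
  F≈F′ : ∀ i → F i ≈ F′ i
  F≈F′ i = ⊛≈* (E.exp (i S.× t)) (exp (i ×ⁿ t))
    (stirling₂ (suc r) i S.× T.binet α β i) (stirling₂ (suc r) i ×ⁿ binetSeries i)
    (exp≈exp (i S.× t) (i ×ⁿ t) (×≈× i t t (λ _ → refl)))
    (×≈× (stirling₂ (suc r) i) (T.binet α β i) (binetSeries i) (binet≈binetSeries i))
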